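{- $\mathrm{Solve}_{\leqslant}(\mathrm{CR}) \leq_{\mathrm{FP}} \mathrm{Solve}(\mathrm{CycG})$; that is, there is an $\mathrm{FP}$-interpretation $\mathcal{I}$ of $\tau_{\text{les-g}}$ in $\tau_{\text{les-r}}^{\leqslant}$ such that for every $\tau_{\text{les-r}}^{\leqslant}$-structure $\mathcal{S}$ (encoding a linear equation system over a finite commutative ring equipped with a linear order) we have $\mathcal{S} \in \mathrm{Solve}_{\leqslant}(\mathrm{CR})$ if and only if $\mathcal{I}(\mathcal{S}) \in \mathrm{Solve}(\mathrm{CycG})$.
   Context: All structures are finite. $\mathrm{FP}$ denotes inflationary fixed-point logic. An $m$-ary $\mathcal{L}$-interpretation of a vocabulary $\tau$ in a vocabulary $\sigma$ is a tuple of $\mathcal{L}[\sigma]$-formulas $\delta(\bar x)$, $\varepsilon(\bar x,\bar y)$, $\phi_R(\bar x_1,\dots,\bar x_k)$ for each $k$-ary $R\in\tau$, and $\gamma_c(\bar x)$ for each constant $c\in\tau$ (all tuples of length $m$); it maps a $\sigma$-structure $\mathcal A$ to the $\tau$-structure $\mathcal I(\mathcal A)$ whose domain is $\delta^{\mathcal A}$ modulo the equivalence relation $\varepsilon^{\mathcal A}$, with relations and constants defined by the $\phi_R,\gamma_c$. For classes $\mathcal C$ of $\sigma$-structures and $\mathcal D$ of $\tau$-structures (closed under isomorphism), $\mathcal C\leq_{\mathcal L}\mathcal D$ means there is an $\mathcal L$-interpretation $\mathcal I$ of $\tau$ in $\sigma$ with $\mathcal A\in\mathcal C \iff \mathcal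 I(\mathcal A)\in\mathcal D$ for all $\sigma$-structures $\mathcal A$. A linear equation system over a finite Abelian group $G$ is a pair $(A,\mathbf b)$ with $A\colon I\times J\to\{0,1\}$ and $\mathbf b\colon I\to G$ ($I,J$ finite unordered sets); it is solvable if there is $\mathbf c\colon J\to G$ with $\sum_{j\in J}A(i,j)\mathbf c(j)=\mathbf b(i)$ for all $i\in I$. Such systems are encoded as structures over $\tau_{\text{les-g}}=(G,A,b,+,e)$, where $G$ is unary (the group elements), $+,e$ the group operation and identity, and $A,b$ binary relations encoding the matrix and the vector. $\mathrm{Solve}(\mathrm{CycG})$ is the class of $\tau_{\text{les-g}}$-structures encoding solvable systems over finite cyclic groups. A linear equation system over a finite commutative ring $R$ is $(A,\mathbf b)$ with $A\colon I\times J\to R$, $\mathbf b\colon I\to R$; it is solvable if $A\mathbf c=\mathbf b$ for some $\mathbf c\colon J\to R$. These are encoded over $\tau_{\text{les-r}}=(R,A,b,+,\cdot,1,0)$ with $R$ unary (ring elements), $A$ ternary, $b$ binary; $\tau_{\text{les-r}}^{\leqslant}$ adds a binary symbol $\leqslant$ interpreted as a linear order on the ring elements (not required to be compatible with the ring operations). $\mathrm{Solve}_{\leqslant}(\mathrm{CR})$ is the class of $\tau_{\text{les-r}}^{\leqslant}$-structures encoding solvable systems over finite commutative rings with a linear order. -}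

module Defs where

open import Data.Nat using (ℕ; zero; suc; _+_; _*_; _^_)
open import Data.Fin using (Fin; zero; suc) renaming (_≟_ to _≟F_)
open import Data.Bool using (Bool; true; false; T; not; _∧_; _∨_; if_then_else_)
open import Data.List using (List; []; _∷_; length; foldr; allFin)
open import Data.Bool.ListAction using (any; all)
import Data.List as L
open import Data.Vec using (Vec; []; _∷_; _++_; map; concat)
import Data.Vec.Relation.Unary.All as VAll
open import Data.Product using (Σ; ∃; _×_; _,_)
open import Data.Sum using () renaming (_⊎_ to _⊎′_)
open import Relation.Nullary using (¬_)
open import Relation.Nullary.Decidable using (⌊_⌋)
open import Relation.Binary.PropositionalEquality using (_≡_)
open import Function.Bundles using (_⇔_)

record Voc : Set where
  constructor voc
  field
    arities : List ℕ
    consts  : ℕ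

RelSym : Voc → Set
RelSym σ = Fin (length (Voc.arities σ))

ar : (σ : Voc) → RelSym σ → ℕ
ar σ R = L.lookup (Voc.arities σ) R

record Struct (σ : Voc) : Set where
  field
    size : ℕ
    rel  : (R : RelSym σ) → Vec (Fin size) (ar σ R) → Bool
    cst  : Fin (Voc.consts σ) → Fin size

open Struct public

-- Syntax of inflationary fixed-point logic FP.
-- Formula σ Δ v : first-order variables are de Bruijn indices in Fin v,
-- Δ lists the arities of the free (second-order) fixed-point relation
-- variables.

data Term (σ : Voc) (v : ℕ) : Set where
  var : Fin v → Term σ v
  con : Fin (Voc.consts σ) → Term σ v

data RVar : List ℕ → ℕ → Set where
  here  : ∀ {k Δ} → RVar (k ∷ Δ) k
  there : ∀ {k l Δ} → RVar Δ k → RVar (l ∷ Δ) k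

data Formula (σ : Voc) (Δ : List ℕ) (v : ℕ) : Set where
  atom : (R : RelSym σ) → Vec (Term σ v) (ar σ R) → Formula σ Δ v
  rvar : ∀ {k} → RVar Δ k → Vec (Term σ v) k → Formula σ Δ v
  eq   : Term σ v → Term σ v → Formula σ Δ v
  neg  : Formula σ Δ v → Formula σ Δ v
  and  : Formula σ Δ v → Formula σ Δ v → Formula σ Δ v
  or   : Formula σ Δ v → Formula σ Δ v → Formula σ Δ v
  ex   : Formula σ Δ (suc v) → Formula σ Δ v
  fa   : Formula σ Δ (suc v) → Formula σ Δ v
  -- [ifp_{X,x̄} φ](t̄): φ has the new relation variable X (arity k,
  -- the head of the context) and the k new variables x̄ (indices 0..k-1)
  -- besides the old ones (indices k..k+v-1).
  ifp  : (k : ℕ) → Formula σ (k ∷ Δ) (k + v) → Vec (Term σ v) k → Formula σ Δ v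

data REnv (n : ℕ) : List ℕ → Set where
  []  : REnv n []
  _∷_ : ∀ {k Δ} → (Vec (Fin n) k → Bool) → REnv n Δ → REnv n (k ∷ Δ)

lookupR : ∀ {n Δ k} → REnv n Δ → RVar Δ k → Vec (Fin n) k → Bool
lookupR (X ∷ ρ) here      = X
lookupR (X ∷ ρ) (there p) = lookupR ρ p

iter : ∀ {A : Set} → (A → A) → ℕ → A → A
iter f zero    a = a
iter f (suc i) a = f (iter f i a)

evalT : ∀ {σ v} (S : Struct σ) → Vec (Fin (size S)) v → Term σ v → Fin (size S)
evalT S e (var i) = Data.Vec.lookup e i
evalT S e (con c) = cst S c

-- The inflationary fixed point of X ↦ X ∪ φ(X) over k-tuples is reached
-- after at most (size S)^k stages (the stages form an increasing chain of
-- subsets of a set with (size S)^k elements), so stage (size S)^k is it.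
eval : ∀ {σ Δ v} (S : Struct σ) → REnv (size S) Δ → Vec (Fin (size S)) v
       → Formula σ Δ v → Bool
eval S ρ e (atom R ts) = rel S R (map (evalT S e) ts)
eval S ρ e (rvar p ts) = lookupR ρ p (map (evalT S e) ts)
eval S ρ e (eq s t)    = ⌊ evalT S e s ≟F evalT S e t ⌋
eval S ρ e (neg φ)     = not (eval S ρ e φ)
eval S ρ e (and φ ψ)   = eval S ρ e φ ∧ eval S ρ e ψ
eval S ρ e (or φ ψ)    = eval S ρ e φ ∨ eval S ρ e ψ
eval S ρ e (ex φ)      = any (λ a → eval S ρ (a ∷ e) φ) (allFin (size S))
eval S ρ e (fa φ)      = all (λ a → eval S ρ (a ∷ e) φ) (allFin (size S))
eval S ρ e (ifp k φ ts) =
  iter (λ X xs → X xs ∨ eval S (X ∷ ρ) (xs ++ e) φ) (size S ^ k) (λ _ → false)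
       (map (evalT S e) ts)

Sat : ∀ {σ v} (S : Struct σ) → Formula σ [] v → Vec (Fin (size S)) v → Set
Sat S φ a = T (eval S [] a φ)

record Interp (τ σ : Voc) (m : ℕ) : Set where
  field
    δ : Formula σ [] m
    ε : Formula σ [] (m + m)
    φ : (R : RelSym τ) → Formula σ [] (ar τ R * m)
    γ : Fin (Voc.consts τ) → Formula σ [] m

-- IsImage I A B : B is (an isomorphic copy of) I(A), i.e. the quotient of
-- δ^A by ε^A (via the quotient map h), with R^B = {([ā₁],…,[ā_k]) :
-- A ⊨ φ_R(ā₁,…,ā_k)} and c^B = the unique class defined by γ_c.
record IsImage {τ σ m} (I : Interp τ σ m) (A : Struct σ) (B : Struct τ) : Set where
  open Interp I
  Tup = Vec (Fin (size A)) m
  field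
    h     : Tup → Fin (size B)
    onto  : ∀ b → ∃ λ (x : Tup) → Sat A δ x × h x ≡ b
    ker   : ∀ x y → Sat A δ x → Sat A δ y → (h x ≡ h y ⇔ Sat A ε (x ++ y))
    rels  : ∀ R (ys : Vec (Fin (size B)) (ar τ R)) →
            T (rel B R ys) ⇔
            (∃ λ (xs : Vec Tup (ar τ R)) →
               VAll.All (Sat A δ) xs × map h xs ≡ ys × Sat A (φ R) (concat xs))
    csts  : ∀ c → (∃ λ (x : Tup) → Sat A δ x × Sat A (γ c) x)
                × (∀ x → Sat A δ x → Sat A (γ c) x → h x ≡ cst B c)

_≤FP_ : ∀ {σ τ} → (Struct σ → Set) → (Struct τ → Set) → Set
_≤FP_ {σ} {τ} C D = Σ ℕ λ m → Σ (Interp τ σ m) λ I →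
  ∀ (A : Struct σ) →
    (Σ (Struct τ) λ B → IsImage I A B)          -- I(A) is defined
    × (C A ⇔ (Σ (Struct τ) λ B → IsImage I A B × D B))

-- τ_les-g = (G, A, b, +, e):  G unary, A binary, b binary, + ternary
-- (graph of the group operation), e constant.

τg : Voc
τg = voc (1 ∷ 2 ∷ 2 ∷ 3 ∷ []) 1

module LesG (S : Struct τg) where
  n = size S
  isG : Fin n → Bool
  isG x = rel S zero (x ∷ [])
  Ab : Fin n → Fin n → Bool
  Ab x y = rel S (suc zero) (x ∷ y ∷ [])
  bb : Fin n → Fin n → Bool
  bb x g = rel S (suc (suc zero)) (x ∷ g ∷ [])
  plus : Fin n → Fin n → Fin n → Bool
  plus x y z = rel S (suc (suc (suc zero))) (x ∷ y ∷ z ∷ [])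
  e : Fin n
  e = cst S zero
  IsG : Fin n → Set
  IsG x = T (isG x)
  -- row indices: non-group elements carrying a right-hand side;
  -- column indices: all remaining non-group elements.
  isI isJ : Fin n → Bool
  isI x = not (isG x) ∧ any (bb x) (allFin n)
  isJ x = not (isG x) ∧ not (any (bb x) (allFin n))

record SolveCycG (S : Struct τg) : Set where
  open LesG S
  field
    add       : Fin n → Fin n → Fin n
    graph     : ∀ x y z → T (plus x y z) ⇔ (IsG x × IsG y × z ≡ add x y)
    closed    : ∀ x y → IsG x → IsG y → IsG (add x y)
    e∈G       : IsG e
    assoc     : ∀ x y z → IsG x → IsG y → IsG z → add (add x y) z ≡ add x (add y z)
    comm      : ∀ x y → IsG x → IsG y → add x y ≡ add y x
    identity  : ∀ x → IsG x → add e x ≡ x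
    inverse   : ∀ x → IsG x → ∃ λ y → IsG y × add x y ≡ e
    cyclic    : ∃ λ g → IsG g × (∀ x → IsG x → ∃ λ k → x ≡ iter (add g) k e)
    b-shape   : ∀ x g → T (bb x g) → ¬ IsG x × IsG g
    b-fun     : ∀ x g g′ → T (bb x g) → T (bb x g′) → g ≡ g′
    A-shape   : ∀ x y → T (Ab x y) → T (isI x) × T (isJ y)
    sol       : Fin n → Fin n
    sol∈G     : ∀ j → T (isJ j) → IsG (sol j)
    solves    : ∀ i g → T (bb i g) →
                foldr (λ j acc → if Ab i j then add (sol j) acc else acc) e (allFin n) ≡ g

-- τ_les-r^≤ = (R, A, b, +, ·, 1, 0, ≤): R unary, A ternary, b binary,
-- +, · ternary (graphs), ≤ binary; constants 1 (index 0), 0 (index 1).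

τr≤ : Voc
τr≤ = voc (1 ∷ 3 ∷ 2 ∷ 3 ∷ 3 ∷ 2 ∷ []) 2

module LesR (S : Struct τr≤) where
  n = size S
  isR : Fin n → Bool
  isR x = rel S zero (x ∷ [])
  Ab : Fin n → Fin n → Fin n → Bool
  Ab x y r = rel S (suc zero) (x ∷ y ∷ r ∷ [])
  bb : Fin n → Fin n → Bool
  bb x r = rel S (suc (suc zero)) (x ∷ r ∷ [])
  plus times : Fin n → Fin n → Fin n → Bool
  plus x y z = rel S (suc (suc (suc zero))) (x ∷ y ∷ z ∷ [])
  times x y z = rel S (suc (suc (suc (suc zero)))) (x ∷ y ∷ z ∷ [])
  leq : Fin n → Fin n → Bool
  leq x y = rel S (suc (suc (suc (suc (suc zero))))) (x ∷ y ∷ [])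
  one zer : Fin n
  one = cst S zero
  zer = cst S (suc zero)
  IsR : Fin n → Set
  IsR x = T (isR x)
  isI isJ : Fin n → Bool
  isI x = not (isR x) ∧ any (bb x) (allFin n)
  isJ x = not (isR x) ∧ not (any (bb x) (allFin n))

record SolveCR≤ (S : Struct τr≤) : Set where
  open LesR S
  field
    add mul   : Fin n → Fin n → Fin n
    graph+    : ∀ x y z → T (plus x y z) ⇔ (IsR x × IsR y × z ≡ add x y)
    graph·    : ∀ x y z → T (times x y z) ⇔ (IsR x × IsR y × z ≡ mul x y)
    closed+   : ∀ x y → IsR x → IsR y → IsR (add x y)
    closed·   : ∀ x y → IsR x → IsR y → IsR (mul x y)
    one∈R     : IsR one
    zer∈R     : IsR zer
    +-assoc   : ∀ x y z → IsR x → IsR y → IsR z → add (add x y) z ≡ add x (add y z)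
    +-comm    : ∀ x y → IsR x → IsR y → add x y ≡ add y x
    +-ident   : ∀ x → IsR x → add zer x ≡ x
    +-inverse : ∀ x → IsR x → ∃ λ y → IsR y × add x y ≡ zer
    ·-assoc   : ∀ x y z → IsR x → IsR y → IsR z → mul (mul x y) z ≡ mul x (mul y z)
    ·-comm    : ∀ x y → IsR x → IsR y → mul x y ≡ mul y x
    ·-ident   : ∀ x → IsR x → mul one x ≡ x
    distrib   : ∀ x y z → IsR x → IsR y → IsR z → mul x (add y z) ≡ add (mul x y) (mul x z)
    ≤-shape   : ∀ x y → T (leq x y) → IsR x × IsR y
    ≤-refl    : ∀ x → IsR x → T (leq x x)
    ≤-antisym : ∀ x y → T (leq x y) → T (leq y x) → x ≡ y
    ≤-trans   : ∀ x y z → T (leq x y) → T (leq y z) → T (leq x z)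
    ≤-total   : ∀ x y → IsR x → IsR y → T (leq x y) ⊎′ T (leq y x)
    b-shape   : ∀ x r → T (bb x r) → ¬ IsR x × IsR r
    b-fun     : ∀ x r r′ → T (bb x r) → T (bb x r′) → r ≡ r′
    entry     : Fin n → Fin n → Fin n
    A-graph   : ∀ x y r → T (Ab x y r) ⇔ (T (isI x) × T (isJ y) × r ≡ entry x y)
    entry∈R   : ∀ x y → T (isI x) → T (isJ y) → IsR (entry x y)
    sol       : Fin n → Fin n
    sol∈R     : ∀ j → T (isJ j) → IsR (sol j)
    solves    : ∀ i r → T (bb i r) →
                foldr (λ j acc → if isJ j then add (mul (entry i j) (sol j)) acc else acc)
                      zer (allFin n) ≡ r

{-# OPTIONS --safe #-}

-- The multiples of 1 form a cyclic group C ⊆ (R,+), definable by a fixed point,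
-- and C is a subring of R over which R is a module; no basis of R is needed.
-- Write an unknown c(x) ∈ R as Σ_p v(x,p)·p with v(x,p) ∈ C.  The equation of a
-- row i then says that the formal sum Σ v(x,p)·[A(i,x)p] − [b(i)] is sent to 0
-- by the evaluation map C^R → R, [r] ↦ r.  As C has order char R, which kills R,
-- the kernel of this map is generated by the relations [p+q] − [p] − [q].  One
-- new unknown for each row i and each pair p, q, as the coefficient of the
-- relation, leaves one equation over C for each i and each s ∈ R, comparing the
-- coefficients of [s].  The equations at s = 0 are dropped, so that unknowns of
-- weight 0 never matter.  The entries −1 and 2 are avoided by splitting the
-- unknown of a relation into its occurrences at [p], [q] and [p+q], tied
-- together by two further equations.

module Submission where

open import Defs
open import Data.Nat using (ℕ; zero; suc; s≤s; z≤n)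
import Data.Nat as ℕ
import Data.Nat.Properties as ℕₚ
open import Data.Nat.DivMod using (_%_; _/_; m%n<n; m≡m%n+[m/n]*n)
open import Data.Fin using (Fin; zero; suc; toℕ; combine; remQuot; _↑ˡ_; _↑ʳ_; _≟_)
open import Data.Fin.Properties using (any?; pigeonhole; toℕ<n; remQuot-combine; combine-remQuot)
open import Data.Bool using (Bool; true; false; T; not; _∨_; if_then_else_)
open import Data.Bool.Properties using (T?; T-≡; T-∧; T-∨; T-irrelevant)
open import Data.Bool.ListAction using (any; all)
open import Data.List using ([]; _∷_; allFin)
import Data.List as L
open import Data.List.Membership.Propositional using (lose)
open import Data.List.Membership.Propositional.Properties using (∈-allFin)
import Data.List.Relation.Unary.All as ListAll
open import Data.List.Relation.Unary.All.Properties using (all⁺; all⁻)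
import Data.List.Relation.Unary.Any as Any
open import Data.List.Relation.Unary.Any.Properties using (any⁺; any⁻)
open import Data.Maybe using (Maybe; just; nothing; maybe′)
open import Data.Maybe.Properties using (just-injective)
open import Data.Vec using (Vec; []; _∷_; _++_; map; concat; replicate; head; tabulate; lookup)
open import Data.Vec.Properties
  using (≡-dec; ∷-injectiveˡ; ∷-injectiveʳ; lookup-++ˡ; lookup-++ʳ; tabulate∘lookup; tabulate-∘; tabulate-cong; map-cong; map-id; map-∘)
import Data.Vec.Relation.Unary.All as VecAll
import Data.Product as Product
open import Data.Product using (Σ; ∃; _×_; _,_; proj₁; proj₂)
import Data.Sum as Sum
open import Data.Sum using (_⊎_; inj₁; inj₂)
open import Data.Empty using (⊥-elim)
open import Function using (_∘_; id; case_of_)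
open import Function.Bundles using (_⇔_; mk⇔; Equivalence)
open import Level using (0ℓ)
open import Algebra.Bundles using (CommutativeRing)
open import Algebra.Consequences.Propositional using (comm∧idˡ⇒id; comm∧invʳ⇒inv; comm∧distrˡ⇒distr)
open import Algebra.Core using (Op₁; Op₂)
open import Algebra.Structures using (IsCommutativeRing)
open import Relation.Nullary using (¬_; Dec; yes; no; does; ¬?; _×-dec_; contradiction)
open import Relation.Nullary.Decidable using (toWitness; fromWitness)
open import Relation.Binary.PropositionalEquality hiding ([_])
open Equivalence using (to; from)

-- A formal sum is never built as an object: it is tested by functions `φ` from R to R with φ(0) =
-- 0, extended linearly. The indicators of the elements s ≠ 0 give the equations, which leads from a
-- solution c to the unknowns; the identity is the evaluation map, which leads back. In the first
-- direction v(x,·) is the indicator of c(x), so of the kernel only the reduction of [r₁] + ... +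
-- [r_N] to [r₁ + ... + r_N] is used. As C lies inside R, both systems are computed in R. A single
-- unknown for [p+q] - [p] - [q] would produce the entry -1 and, up to sign, the entry 2 when p = q,
-- whereas a matrix over a group has entries 0 and 1 only. The universe of the image consists of all
-- 5-tuples, and each tuple outside the group is a row or a column, depending on whether it carries
-- a right-hand side. Surplus tuples are therefore made harmless: unknowns of equal weight are added
-- up, and rows at s = 0 read 0 = 0. An ill-formed input gets an empty G, which does not contain the
-- neutral element.

T-not : ∀ {b} → T (not b) ⇔ (¬ T b)
T-not {true}  = mk⇔ (λ ()) (λ f → f _)
T-not {false} = mk⇔ (λ _ ()) (λ _ → _)

T-any : ∀ {n} (p : Fin n → Bool) → T (any p (allFin n)) ⇔ ∃ (T ∘ p)
T-any {n} p = mk⇔ (Any.satisfied ∘ any⁻ p (allFin n)) (λ { (x , px) → any⁺ p (lose (∈-allFin x) px) })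

T-all : ∀ {n} (p : Fin n → Bool) → T (all p (allFin n)) ⇔ (∀ x → T (p x))
T-all {n} p = mk⇔ (λ h x → ListAll.lookup (all⁺ p (allFin n) h) (∈-allFin x)) (λ h → all⁻ p (ListAll.universal h (allFin n)))

-- Definability and interpretations

-- Formula and meaning are built by the same combinators, so the correctness of a compound formula
-- comes for free and `Holds` unfolds to a type that can be matched on.
record Definable (σ : Voc) (v : ℕ) : Set₁ where
  field
    formula : Formula σ [] v
    Holds   : (A : Struct σ) → Vec (Fin (size A)) v → Set
    correct : ∀ A e → Sat A formula e ⇔ Holds A e

open Definable public

module _ {σ : Voc} {v : ℕ} where

  infix  9 _≐_
  infix  8 ∼_
  infixr 7 _⊓_
  infixr 6 _⊔_
  infixr 5 _⇛_

  atomᵈ : (R : RelSym σ) → Vec (Term σ v) (ar σ R) → Definable σ v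
  atomᵈ R ts = record
    { formula = atom R ts
    ; Holds   = λ A e → T (rel A R (map (evalT A e) ts))
    ; correct = λ A e → mk⇔ id id }

  _≐_ : Term σ v → Term σ v → Definable σ v
  s ≐ t = record
    { formula = eq s t
    ; Holds   = λ A e → evalT A e s ≡ evalT A e t
    ; correct = λ A e → mk⇔ toWitness fromWitness }

  ∼_ : Definable σ v → Definable σ v
  ∼ P = record
    { formula = neg (formula P)
    ; Holds   = λ A e → ¬ Holds P A e
    ; correct = λ A e → mk⇔ (λ h → to T-not h ∘ from (correct P A e)) (λ h → from T-not (h ∘ to (correct P A e))) }

  _⊓_ _⊔_ _⇛_ : Definable σ v → Definable σ v → Definable σ v
  P ⊓ Q = record
    { formula = and (formula P) (formula Q)
    ; Holds   = λ A e → Holds P A e × Holds Q A e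
    ; correct = λ A e → mk⇔ (Product.map (to (correct P A e)) (to (correct Q A e)) ∘ to T-∧)
                            (from T-∧ ∘ Product.map (from (correct P A e)) (from (correct Q A e))) }
  P ⊔ Q = record
    { formula = or (formula P) (formula Q)
    ; Holds   = λ A e → Holds P A e ⊎ Holds Q A e
    ; correct = λ A e → mk⇔ (Sum.map (to (correct P A e)) (to (correct Q A e)) ∘ to T-∨)
                            (from T-∨ ∘ Sum.map (from (correct P A e)) (from (correct Q A e))) }
  P ⇛ Q = record
    { formula = or (neg (formula P)) (formula Q)
    ; Holds   = λ A e → Holds P A e → Holds Q A e
    ; correct = λ A e → mk⇔
        (λ h p → Sum.[ (λ np → contradiction (from (correct P A e) p) (to T-not np)) , to (correct Q A e) ] (to T-∨ h))
        (λ h → from T-∨ (case T? (eval A [] e (formula P)) of λ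
          { (yes p) → inj₂ (from (correct Q A e) (h (to (correct P A e) p)))
          ; (no ¬p) → inj₁ (from T-not ¬p) })) }

  ∃ᵈ ∀ᵈ : Definable σ (suc v) → Definable σ v
  ∃ᵈ P = record
    { formula = ex (formula P)
    ; Holds   = λ A e → ∃ λ a → Holds P A (a ∷ e)
    ; correct = λ A e → mk⇔ (Product.map₂ (λ {a} → to (correct P A (a ∷ e))) ∘ to (T-any _))
                            (from (T-any _) ∘ Product.map₂ (λ {a} → from (correct P A (a ∷ e)))) }
  ∀ᵈ P = record
    { formula = fa (formula P)
    ; Holds   = λ A e → ∀ a → Holds P A (a ∷ e)
    ; correct = λ A e → mk⇔ (λ h a → to (correct P A (a ∷ e)) (to (T-all _) h a))
                            (λ h → from (T-all _) (λ a → from (correct P A (a ∷ e)) (h a))) }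

module _ {σ : Voc} {v : ℕ} where

  ⊤ᵈ : Definable σ v
  ⊤ᵈ = ∀ᵈ (var zero ≐ var zero)

  equalᵈ : ∀ {m} → Vec (Term σ v) m → Vec (Term σ v) m → Definable σ v
  equalᵈ ss ts = record
    { formula = conjunction ss ts
    ; Holds   = λ A e → map (evalT A e) ss ≡ map (evalT A e) ts
    ; correct = λ A e → mk⇔ (sound ss ts) (complete ss ts) }
    where
    conjunction : ∀ {m} → Vec (Term σ v) m → Vec (Term σ v) m → Formula σ _ v
    conjunction []       []       = formula ⊤ᵈ
    conjunction (s ∷ ss) (t ∷ ts) = and (eq s t) (conjunction ss ts)
    sound : ∀ {m A e} (ss ts : Vec (Term σ v) m) → Sat A (conjunction ss ts) e → map (evalT A e) ss ≡ map (evalT A e) ts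
    sound []       []       _ = refl
    sound {A = A} {e} (s ∷ ss) (t ∷ ts) h = let p , q = to T-∧ h in cong₂ _∷_ (to (correct (s ≐ t) A e) p) (sound ss ts q)
    complete : ∀ {m A e} (ss ts : Vec (Term σ v) m) → map (evalT A e) ss ≡ map (evalT A e) ts → Sat A (conjunction ss ts) e
    complete {A = A} {e} [] [] _ = from (correct ⊤ᵈ A e) (λ _ → refl)
    complete {A = A} {e} (s ∷ ss) (t ∷ ts) h = from T-∧ (from (correct (s ≐ t) A e) (∷-injectiveˡ h) , complete ss ts (∷-injectiveʳ h))

-- Coding tuples as elements of a finite set

module _ {k : ℕ} where

  toIndex : ∀ {m} → Vec (Fin k) m → Fin (k ℕ.^ m)
  toIndex []       = zero
  toIndex (x ∷ xs) = combine x (toIndex xs)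

  fromIndex : ∀ m → Fin (k ℕ.^ m) → Vec (Fin k) m
  fromIndex zero    _ = []
  fromIndex (suc m) i = let x , j = remQuot (k ℕ.^ m) i in x ∷ fromIndex m j

  from-toIndex : ∀ {m} (xs : Vec (Fin k) m) → fromIndex m (toIndex xs) ≡ xs
  from-toIndex [] = refl
  from-toIndex {suc m} (x ∷ xs) = cong₂ _∷_ (cong proj₁ split) (trans (cong (fromIndex m ∘ proj₂) split) (from-toIndex xs))
    where
    split : remQuot (k ℕ.^ m) (combine x (toIndex xs)) ≡ (x , toIndex xs)
    split = remQuot-combine x (toIndex xs)

  to-fromIndex : ∀ m (i : Fin (k ℕ.^ m)) → toIndex (fromIndex m i) ≡ i
  to-fromIndex zero    zero = refl
  to-fromIndex (suc m) i = let x , j = remQuot (k ℕ.^ m) i in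
    trans (cong (combine {k} x) (to-fromIndex m j)) (combine-remQuot {k} (k ℕ.^ m) i)

-- Interpretations whose universe is the set of all m-tuples

module QuotientFree {τ σ : Voc} {m : ℕ}
  (φᵈ : ∀ R → Definable σ (ar τ R ℕ.* m)) (γᵗ : Fin (Voc.consts τ) → Vec (Fin (Voc.consts σ)) m) where

  interp : Interp τ σ m
  interp = record
    { δ = formula ⊤ᵈ
    ; ε = formula (equalᵈ (tabulate (var ∘ (_↑ˡ m))) (tabulate (var ∘ (m ↑ʳ_))))
    ; φ = λ R → formula (φᵈ R)
    ; γ = λ c → formula (equalᵈ (tabulate var) (map con (γᵗ c))) }

  open Interp interp

  module _ (A : Struct σ) where

    Tuple : Set
    Tuple = Vec (Fin (size A)) m

    constant : Fin (Voc.consts τ) → Tuple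
    constant c = map (cst A) (γᵗ c)

    δ-holds : ∀ x → Sat A δ x
    δ-holds x = from (correct ⊤ᵈ A x) (λ _ → refl)

    eval-tabulate : ∀ {v} {e : Vec (Fin (size A)) v} (f : Fin m → Fin v) (x : Tuple) → (∀ i → lookup e (f i) ≡ lookup x i) →
                    map (evalT A e) (tabulate (var ∘ f)) ≡ x
    eval-tabulate {e = e} f x hyp = trans (sym (tabulate-∘ (evalT A e) (var ∘ f))) (trans (tabulate-cong hyp) (tabulate∘lookup x))

    ε-holds : ∀ x y → Sat A ε (x ++ y) ⇔ x ≡ y
    ε-holds x y = mk⇔ (λ h → trans (sym left) (trans (to c h) right)) (λ h → from c (trans left (trans h (sym right))))
      where
      c = correct (equalᵈ (tabulate (var ∘ (_↑ˡ m))) (tabulate (var ∘ (m ↑ʳ_)))) A (x ++ y)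
      left  = eval-tabulate (_↑ˡ m) x (lookup-++ˡ x y)
      right = eval-tabulate (m ↑ʳ_) y (lookup-++ʳ x y)

    γ-holds : ∀ c x → Sat A (γ c) x ⇔ x ≡ constant c
    γ-holds c x = mk⇔ (λ h → trans (sym left) (trans (to d h) right)) (λ h → from d (trans left (trans h (sym right))))
      where
      d = correct (equalᵈ (tabulate var) (map con (γᵗ c))) A x
      left  = eval-tabulate id x (λ _ → refl)
      right = sym (map-∘ (evalT A x) con (γᵗ c))

    image : Σ (Struct τ) (IsImage interp A)
    image = B , record
      { h    = toIndex
      ; onto = λ b → fromIndex m b , δ-holds (fromIndex m b) , to-fromIndex m b
      ; ker  = λ x y _ _ → mk⇔ (λ h → from (ε-holds x y) (trans (sym (from-toIndex x)) (trans (cong (fromIndex m) h) (from-toIndex y))))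
                               (λ h → cong toIndex (to (ε-holds x y) h))
      ; rels = λ R ys → mk⇔
          (λ h → map (fromIndex m) ys , VecAll.universal δ-holds _
               , trans (sym (map-∘ toIndex (fromIndex m) ys)) (trans (map-cong (to-fromIndex m) ys) (map-id ys)) , h)
          (λ { (xs , _ , refl , h) → subst (Sat A (φ R) ∘ concat)
               (sym (trans (sym (map-∘ (fromIndex m) toIndex xs)) (trans (map-cong from-toIndex xs) (map-id xs)))) h })
      ; csts = λ c → (constant c , δ-holds (constant c) , from (γ-holds c _) refl) , (λ x _ h → cong toIndex (to (γ-holds c x) h)) }
      where
      B : Struct τ
      B = record
        { size = size A ℕ.^ m
        ; rel  = λ R ys → eval A [] (concat (map (fromIndex m) ys)) (φ R)
        ; cst  = λ c → toIndex (constant c) }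

    -- Reducibility speaks of every isomorphic copy of the image. As the domain formula is true and
    -- the congruence is equality, `h` is a bijection with inverse `g`, and each copy can be studied
    -- through tuples.
    module Image {B : Struct τ} (isImage : IsImage interp A B) where
      open IsImage isImage public using (h)
      open IsImage isImage using (onto; ker; rels; csts)

      g : Fin (size B) → Tuple
      g b = proj₁ (onto b)

      h-g : ∀ b → h (g b) ≡ b
      h-g b = proj₂ (proj₂ (onto b))

      h-injective : ∀ {x y} → h x ≡ h y → x ≡ y
      h-injective {x} {y} e≡ = to (ε-holds x y) (to (ker x y (δ-holds x) (δ-holds y)) e≡)

      g-h : ∀ x → g (h x) ≡ x
      g-h x = h-injective (h-g (h x))

      rel-h : ∀ R xs → T (rel B R (map h xs)) ⇔ Holds (φᵈ R) A (concat xs)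
      rel-h R xs = mk⇔ (λ r → let xs′ , _ , e≡ , s = to (rels R (map h xs)) r in
                              to (correct (φᵈ R) A (concat xs)) (subst (Sat A (φ R) ∘ concat) (map-h-injective e≡) s))
                       (λ s → from (rels R (map h xs)) (xs , VecAll.universal δ-holds xs , refl , from (correct (φᵈ R) A (concat xs)) s))
        where
        map-h-injective : ∀ {k} {xs ys : Vec Tuple k} → map h xs ≡ map h ys → xs ≡ ys
        map-h-injective {xs = []}     {[]}     _  = refl
        map-h-injective {xs = x ∷ xs} {y ∷ ys} e≡ = cong₂ _∷_ (h-injective (∷-injectiveˡ e≡)) (map-h-injective (∷-injectiveʳ e≡))

      cst-h : ∀ c → h (constant c) ≡ cst B c
      cst-h c = proj₂ (csts c) (constant c) (δ-holds (constant c)) (from (γ-holds c _) refl)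

-- Weighted sums over a finite commutative ring

-- K lies inside Fin n, as the ring of a structure whose universe also contains
-- the index sets; dec is undefined outside of it.
module FiniteRing {n : ℕ} {K : Set} {_⊕_ _⊗_ : Op₂ K} {⊖_ : Op₁ K} {𝟘 𝟙 : K}
  (isCommutativeRing : IsCommutativeRing _≡_ _⊕_ _⊗_ ⊖_ 𝟘 𝟙)
  (enc : K → Fin n) (dec : Fin n → Maybe K)
  (dec-enc : ∀ k → dec (enc k) ≡ just k)
  (enc-dec : ∀ {p k} → dec p ≡ just k → enc k ≡ p)
  where

  ring : CommutativeRing 0ℓ 0ℓ
  ring = record { isCommutativeRing = isCommutativeRing }

  open CommutativeRing ring public using (_+_; _*_; -_; 0#; 1#)
  open CommutativeRing ring
    using ( semiring; +-identityˡ; +-identityʳ; +-assoc; +-comm; -‿inverseˡ; -‿inverseʳ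
          ; *-identityˡ; *-identityʳ; *-comm; *-assoc; zeroˡ; zeroʳ; distribˡ; distribʳ )
  open import Algebra.Properties.Semiring.Sum semiring public using (sum; ∑-distrib-+; ∑-comm; *-distribˡ-sum; sum-cong-≗; sum-replicate-zero)
  open import Algebra.Properties.Semiring.Mult semiring public using () renaming (_×_ to _·_; ×-homo-+ to ·-homo-+; ×-assocˡ to ·-assocˡ)
  open import Algebra.Properties.Ring (CommutativeRing.ring ring) using (-‿distribʳ-*)
  open import Algebra.Properties.AbelianGroup (CommutativeRing.+-abelianGroup ring) using (inverseʳ-unique) renaming (∙-cancelˡ to +-cancelˡ)
  open import Algebra.Properties.CommutativeSemigroup (CommutativeRing.+-commutativeSemigroup ring) using (x∙yz≈y∙xz)
  open ≡-Reasoning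

  enc-injective : ∀ {k l} → enc k ≡ enc l → k ≡ l
  enc-injective {k} {l} e≡ = just-injective (trans (sym (dec-enc k)) (trans (cong dec e≡) (dec-enc l)))

  infixr 3 _▸_
  -- The Iverson bracket times `k`. Only `does` is inspected, so `T? b ▸ k` is by definition the
  -- conditional `if b then k else 0#` of the encoded sums.
  _▸_ : ∀ {P : Set} → Dec P → K → K
  d ▸ k = if does d then k else 0#

  private variable
    P Q : Set
    m N : ℕ

  ▸-yes : (d : Dec P) {k : K} → P → (d ▸ k) ≡ k
  ▸-yes (yes _) p = refl
  ▸-yes (no ¬p) p = ⊥-elim (¬p p)

  ▸-no : (d : Dec P) {k : K} → ¬ P → (d ▸ k) ≡ 0#
  ▸-no (yes p) ¬p = ⊥-elim (¬p p)
  ▸-no (no _)  ¬p = refl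

  ▸-0# : (d : Dec P) → (d ▸ 0#) ≡ 0#
  ▸-0# (yes _) = refl
  ▸-0# (no _)  = refl

  ▸-cong : (d : Dec P) (e : Dec Q) {k l : K} → (P → Q) → (Q → P) → (P → k ≡ l) → (d ▸ k) ≡ (e ▸ l)
  ▸-cong (yes p) e f g e≡ = trans (e≡ p) (sym (▸-yes e (f p)))
  ▸-cong (no ¬p) e f g e≡ = sym (▸-no e (¬p ∘ g))

  ▸-congʳ : (d : Dec P) {k l : K} → (P → k ≡ l) → (d ▸ k) ≡ (d ▸ l)
  ▸-congʳ d = ▸-cong d d id id

  *-▸ : (d : Dec P) (a : K) {k : K} → a * (d ▸ k) ≡ (d ▸ a * k)
  *-▸ (yes _) a = refl
  *-▸ (no _)  a = zeroʳ a

  ∑-0 : ∀ {f : Fin N → K} → (∀ i → f i ≡ 0#) → sum f ≡ 0#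
  ∑-0 {N} f≡0 = trans (sum-cong-≗ f≡0) (sum-replicate-zero N)

  ∑-δ : (i : Fin N) (f : Fin N → K) → sum (λ j → j ≟ i ▸ f j) ≡ f i
  ∑-δ {suc N} zero f = trans (cong (f zero +_) (sum-replicate-zero N)) (+-identityʳ _)
  ∑-δ (suc i) f = trans (+-identityˡ _) (∑-δ i (f ∘ suc))

  ∑V : ∀ m → (Vec (Fin n) m → K) → K
  ∑V zero    f = f []
  ∑V (suc m) f = sum (λ x → ∑V m (λ xs → f (x ∷ xs)))

  ∑V-cong : ∀ m {f g : Vec (Fin n) m → K} → (∀ xs → f xs ≡ g xs) → ∑V m f ≡ ∑V m g
  ∑V-cong zero    f≡g = f≡g []
  ∑V-cong (suc m) f≡g = sum-cong-≗ (λ x → ∑V-cong m (λ xs → f≡g (x ∷ xs)))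

  ∑V-0 : ∀ m {f : Vec (Fin n) m → K} → (∀ xs → f xs ≡ 0#) → ∑V m f ≡ 0#
  ∑V-0 zero    f≡0 = f≡0 []
  ∑V-0 (suc m) f≡0 = ∑-0 (λ x → ∑V-0 m (λ xs → f≡0 (x ∷ xs)))

  ∑V-comm : ∀ m (f : Fin N → Vec (Fin n) m → K) →
            sum (λ i → ∑V m (f i)) ≡ ∑V m (λ xs → sum (λ i → f i xs))
  ∑V-comm zero    f = refl
  ∑V-comm (suc m) f = trans (∑-comm (λ i x → ∑V m (λ xs → f i (x ∷ xs))))
                            (sum-cong-≗ (λ x → ∑V-comm m (λ i xs → f i (x ∷ xs))))

  *-distribˡ-∑V : ∀ m a (f : Vec (Fin n) m → K) → a * ∑V m f ≡ ∑V m (λ xs → a * f xs)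
  *-distribˡ-∑V zero    a f = refl
  *-distribˡ-∑V (suc m) a f = trans (*-distribˡ-sum a (λ x → ∑V m (λ xs → f (x ∷ xs))))
                                    (sum-cong-≗ (λ x → *-distribˡ-∑V m a (λ xs → f (x ∷ xs))))

  ∑V-▸ : ∀ m (d : Dec P) (f : Vec (Fin n) m → K) → ∑V m (λ xs → d ▸ f xs) ≡ (d ▸ ∑V m f)
  ∑V-▸ m (yes _) f = refl
  ∑V-▸ m (no _)  f = ∑V-0 m (λ _ → refl)

  _≟V_ : (xs ys : Vec (Fin n) m) → Dec (xs ≡ ys)
  _≟V_ = ≡-dec _≟_

  ∑V-δ : ∀ m (ys : Vec (Fin n) m) (f : Vec (Fin n) m → K) → ∑V m (λ xs → xs ≟V ys ▸ f xs) ≡ f ys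
  ∑V-δ zero    []       f = refl
  ∑V-δ (suc m) (y ∷ ys) f = begin
    sum (λ x → ∑V m (λ xs → (x ∷ xs) ≟V (y ∷ ys) ▸ f (x ∷ xs)))
      ≡⟨ sum-cong-≗ (λ x → ∑V-cong m (λ xs → split x xs)) ⟩
    sum (λ x → ∑V m (λ xs → x ≟ y ▸ xs ≟V ys ▸ f (x ∷ xs)))
      ≡⟨ sum-cong-≗ (λ x → trans (∑V-▸ m (x ≟ y) _) (▸-congʳ (x ≟ y) (λ _ → ∑V-δ m ys _))) ⟩
    sum (λ x → x ≟ y ▸ f (x ∷ ys))
      ≡⟨ ∑-δ y _ ⟩
    f (y ∷ ys) ∎
    where
    split : ∀ x xs → ((x ∷ xs) ≟V (y ∷ ys) ▸ f (x ∷ xs)) ≡ (x ≟ y ▸ xs ≟V ys ▸ f (x ∷ xs))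
    split x xs with x ≟ y
    ... | yes _ = refl
    ... | no _  = refl

  -- Both sides count the pairs (y , xs) with h xs ≡ y.
  ∑-reindex : (h : Vec (Fin n) m → Fin N) (g : Fin N → Vec (Fin n) m) →
              (∀ y → h (g y) ≡ y) → (∀ xs → g (h xs) ≡ xs) →
              (f : Fin N → K) → sum f ≡ ∑V m (f ∘ h)
  ∑-reindex {m} h g hg gh f = begin
    sum f
      ≡⟨ sum-cong-≗ (λ y → sym (∑V-δ m (g y) (λ _ → f y))) ⟩
    sum (λ y → ∑V m (λ xs → xs ≟V g y ▸ f y))
      ≡⟨ ∑V-comm m (λ y xs → xs ≟V g y ▸ f y) ⟩
    ∑V m (λ xs → sum (λ y → xs ≟V g y ▸ f y))
      ≡⟨ ∑V-cong m (λ xs → sum-cong-≗ (λ y → ▸-cong (xs ≟V g y) (y ≟ h xs)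
           (λ e → trans (sym (hg y)) (cong h (sym e))) (λ e → trans (sym (gh xs)) (cong g (sym e))) (λ _ → refl))) ⟩
    ∑V m (λ xs → sum (λ y → y ≟ h xs ▸ f y))
      ≡⟨ ∑V-cong m (λ xs → ∑-δ (h xs) f) ⟩
    ∑V m (f ∘ h) ∎

  -- Sums over the ring inside the universe

  onR : (K → K) → Fin n → K
  onR f p = maybe′ f 0# (dec p)

  onR-enc : ∀ f k → onR f (enc k) ≡ f k
  onR-enc f k = cong (maybe′ f 0#) (dec-enc k)

  onR-cong : ∀ {f g} p → (∀ r → enc r ≡ p → f r ≡ g r) → onR f p ≡ onR g p
  onR-cong p f≡g with dec p in e≡
  ... | just r  = f≡g r (enc-dec e≡)
  ... | nothing = refl

  onR-0 : ∀ {f} p → (∀ r → f r ≡ 0#) → onR f p ≡ 0#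
  onR-0 p f≡0 with dec p
  ... | just r  = f≡0 r
  ... | nothing = refl

  onR-+ : ∀ f g p → onR (λ r → f r + g r) p ≡ onR f p + onR g p
  onR-+ f g p with dec p
  ... | just r  = refl
  ... | nothing = sym (+-identityʳ 0#)

  onR-∑V : ∀ m (f : K → Vec (Fin n) m → K) p → onR (λ r → ∑V m (f r)) p ≡ ∑V m (λ xs → onR (λ r → f r xs) p)
  onR-∑V m f p with dec p
  ... | just r  = refl
  ... | nothing = sym (∑V-0 m (λ _ → refl))

  ∑R : (K → K) → K
  ∑R f = sum (onR f)

  ∑R-cong : ∀ {f g} → (∀ r → f r ≡ g r) → ∑R f ≡ ∑R g
  ∑R-cong f≡g = sum-cong-≗ (λ p → onR-cong p (λ r _ → f≡g r))

  ∑R-+ : ∀ f g → ∑R (λ r → f r + g r) ≡ ∑R f + ∑R g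
  ∑R-+ f g = trans (sum-cong-≗ (onR-+ f g)) (∑-distrib-+ (onR f) (onR g))

  ∑R-0 : ∀ {f} → (∀ r → f r ≡ 0#) → ∑R f ≡ 0#
  ∑R-0 f≡0 = ∑-0 (λ p → onR-0 p f≡0)

  ∑R-δ : ∀ k f → ∑R (λ r → enc k ≟ enc r ▸ f r) ≡ f k
  ∑R-δ k f = begin
    sum (onR (λ r → enc k ≟ enc r ▸ f r))
      ≡⟨ sum-cong-≗ pull ⟩
    sum (λ p → p ≟ enc k ▸ onR f p)
      ≡⟨ ∑-δ (enc k) (onR f) ⟩
    onR f (enc k)
      ≡⟨ onR-enc f k ⟩
    f k ∎
    where
    pull : ∀ p → onR (λ r → enc k ≟ enc r ▸ f r) p ≡ (p ≟ enc k ▸ onR f p)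
    pull p with dec p in e≡
    ... | just r  = ▸-cong (enc k ≟ enc r) (p ≟ enc k)
                      (λ e → trans (sym (enc-dec e≡)) (sym e)) (λ e → sym (trans (enc-dec e≡) e)) (λ _ → refl)
    ... | nothing = sym (▸-0# (p ≟ enc k))

  -- Multiples of 1 and the reduction of formal sums

  Multiple : K → Set
  Multiple k = ∃ λ m → m · 1# ≡ k

  multiple-0 : Multiple 0#
  multiple-0 = 0 , refl

  multiple-1 : Multiple 1#
  multiple-1 = 1 , +-identityʳ 1#

  multiple-+ : ∀ {k l} → Multiple k → Multiple l → Multiple (k + l)
  multiple-+ (i , refl) (j , refl) = i ℕ.+ j , ·-homo-+ 1# i j

  multiple-▸ : (d : Dec P) {k : K} → Multiple k → Multiple (d ▸ k)
  multiple-▸ (yes _) mk = mk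
  multiple-▸ (no _)  mk = multiple-0

  -- The linear extension of `φ` evaluated at the relation [r + s] - [r] - [s].
  Δ : (K → K) → K → K → K
  Δ φ r s = φ (r + s) + - (φ r + φ s)

  -- Adding up the sequence from the right, one summand α₀ at a time, uses the
  -- relation at (α₀ , sum of the rest) once per summand.
  telescope : (α : Fin N → K) → ∃ λ (ζ : K → K → K) → (∀ r s → Multiple (ζ r s)) ×
              (∀ φ → φ 0# ≡ 0# → sum (φ ∘ α) + ∑R (λ r → ∑R (λ s → ζ r s * Δ φ r s)) ≡ φ (sum α))
  telescope {zero} α = (λ _ _ → 0#) , (λ _ _ → multiple-0) , λ φ φ0 →
    trans (+-identityˡ _) (trans (∑R-0 (λ r → ∑R-0 (λ s → zeroˡ _))) (sym φ0))
  telescope {suc N} α with telescope (α ∘ suc)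
  ... | ζ , mζ , tζ = ζ′ , (λ r s → multiple-+ (mζ r s) (multiple-▸ (enc a₀ ≟ enc r) (multiple-▸ (enc t ≟ enc s) multiple-1))) , e≡
    where
    a₀ t : K
    a₀ = α zero
    t = sum (α ∘ suc)
    δ ζ′ : K → K → K
    δ r s = enc a₀ ≟ enc r ▸ enc t ≟ enc s ▸ 1#
    ζ′ r s = ζ r s + δ r s
    e≡ : ∀ φ → φ 0# ≡ 0# → sum (φ ∘ α) + ∑R (λ r → ∑R (λ s → ζ′ r s * Δ φ r s)) ≡ φ (sum α)
    e≡ φ φ0 = begin
      (φ a₀ + A) + ∑R (λ r → ∑R (λ s → ζ′ r s * Δ φ r s))
        ≡⟨ cong ((φ a₀ + A) +_) (trans (∑R-cong (λ r → trans (∑R-cong (λ s → distribʳ _ _ _)) (∑R-+ _ _))) (∑R-+ _ _)) ⟩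
      (φ a₀ + A) + (B + ∑R (λ r → ∑R (λ s → δ r s * Δ φ r s)))
        ≡⟨ cong (λ y → (φ a₀ + A) + (B + y)) δΔ ⟩
      (φ a₀ + A) + (B + Δ φ a₀ t)
        ≡⟨ sym (+-assoc (φ a₀ + A) B _) ⟩
      ((φ a₀ + A) + B) + Δ φ a₀ t
        ≡⟨ cong (_+ Δ φ a₀ t) (trans (+-assoc (φ a₀) A B) (cong (φ a₀ +_) (tζ φ φ0))) ⟩
      (φ a₀ + φ t) + (φ (a₀ + t) + - (φ a₀ + φ t))
        ≡⟨ trans (x∙yz≈y∙xz _ _ _) (trans (cong (φ (a₀ + t) +_) (-‿inverseʳ _)) (+-identityʳ _)) ⟩
      φ (a₀ + t) ∎
      where
      A B : K
      A = sum (φ ∘ α ∘ suc)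
      B = ∑R (λ r → ∑R (λ s → ζ r s * Δ φ r s))
      guard-* : (d : Dec P) (e : Dec Q) (k : K) → (d ▸ e ▸ 1#) * k ≡ (d ▸ e ▸ k)
      guard-* (yes _) (yes _) k = *-identityˡ k
      guard-* (yes _) (no _)  k = zeroˡ k
      guard-* (no _)  e       k = zeroˡ k
      pull : ∀ (d : Dec P) f → ∑R (λ s → d ▸ f s) ≡ (d ▸ ∑R f)
      pull (yes _) f = refl
      pull (no _)  f = ∑R-0 (λ _ → refl)
      δΔ : ∑R (λ r → ∑R (λ s → δ r s * Δ φ r s)) ≡ Δ φ a₀ t
      δΔ = begin
        ∑R (λ r → ∑R (λ s → δ r s * Δ φ r s))
          ≡⟨ ∑R-cong (λ r → trans (∑R-cong (λ s → guard-* (enc a₀ ≟ enc r) (enc t ≟ enc s) _)) (pull (enc a₀ ≟ enc r) _)) ⟩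
        ∑R (λ r → enc a₀ ≟ enc r ▸ ∑R (λ s → enc t ≟ enc s ▸ Δ φ r s))
          ≡⟨ ∑R-δ a₀ _ ⟩
        ∑R (λ s → enc t ≟ enc s ▸ Δ φ a₀ s)
          ≡⟨ ∑R-δ t _ ⟩
        Δ φ a₀ t ∎

  ·-zeroʳ : ∀ m → m · 0# ≡ 0#
  ·-zeroʳ zero    = refl
  ·-zeroʳ (suc m) = trans (+-identityˡ _) (·-zeroʳ m)

  -- Two of the n + 1 multiples 0 · 1, ..., n · 1 coincide, and their indices differ by at most n.
  -- This bound is what lets the fixed point exhaust the multiples of 1 within its stages.
  characteristic : ∃ λ d → suc d ℕ.≤ n × suc d · 1# ≡ 0#
  characteristic with pigeonhole (ℕₚ.n<1+n n) (λ j → enc (toℕ j · 1#))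
  ... | i , j , i<j , e≡ with ℕₚ.m≤n⇒∃[o]m+o≡n i<j
  ... | d , i+d≡j = d , bound , +-cancelˡ (toℕ i · 1#) _ _ (begin
    toℕ i · 1# + suc d · 1#   ≡⟨ sym (·-homo-+ 1# (toℕ i) (suc d)) ⟩
    (toℕ i ℕ.+ suc d) · 1#    ≡⟨ cong (_· 1#) (trans (ℕₚ.+-suc (toℕ i) d) i+d≡j) ⟩
    toℕ j · 1#                ≡⟨ sym (enc-injective e≡) ⟩
    toℕ i · 1#                ≡⟨ sym (+-identityʳ _) ⟩
    toℕ i · 1# + 0#           ∎)
    where
    bound : suc d ℕ.≤ n
    bound = ℕₚ.≤-trans (subst (suc d ℕ.≤_) (trans (ℕₚ.+-suc (toℕ i) d) i+d≡j) (ℕₚ.m≤n+m (suc d) (toℕ i)))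
                       (ℕₚ.≤-pred (toℕ<n j))

  multiple-of-characteristic : ∀ m {d} → d · 1# ≡ 0# → (m ℕ.* d) · 1# ≡ 0#
  multiple-of-characteristic m {d} d·1≡0 = trans (sym (·-assocˡ 1# m d)) (trans (cong (m ·_) d·1≡0) (·-zeroʳ m))

  -- If `suc d` kills 1, then so does m + m · d, so `m ℕ.* d` is the natural number that represents
  -- -m.
  multiple-neg : ∀ {k} → Multiple k → Multiple (- k)
  multiple-neg {k} (m , refl) with characteristic
  ... | d , _ , d·1≡0 = m ℕ.* d , inverseʳ-unique (m · 1#) ((m ℕ.* d) · 1#) (begin
    m · 1# + (m ℕ.* d) · 1#  ≡⟨ sym (·-homo-+ 1# m (m ℕ.* d)) ⟩
    (m ℕ.+ m ℕ.* d) · 1#     ≡⟨ cong (_· 1#) (sym (ℕₚ.*-suc m d)) ⟩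
    (m ℕ.* suc d) · 1#       ≡⟨ multiple-of-characteristic m d·1≡0 ⟩
    0#                       ∎)

  multiple-bounded : ∀ {k} → Multiple k → ∃ λ m → m ℕ.< n × m · 1# ≡ k
  multiple-bounded {k} (m , refl) with characteristic
  ... | d , d≤n , d·1≡0 = m % suc d , ℕₚ.<-≤-trans (m%n<n m (suc d)) d≤n , sym (begin
    m · 1#                                                  ≡⟨ cong (_· 1#) (m≡m%n+[m/n]*n m (suc d)) ⟩
    (m % suc d ℕ.+ m / suc d ℕ.* suc d) · 1#                ≡⟨ ·-homo-+ 1# (m % suc d) _ ⟩
    (m % suc d) · 1# + (m / suc d ℕ.* suc d) · 1#           ≡⟨ cong ((m % suc d) · 1# +_) (multiple-of-characteristic (m / suc d) d·1≡0) ⟩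
    (m % suc d) · 1# + 0#                                   ≡⟨ +-identityʳ _ ⟩
    (m % suc d) · 1#                                        ∎)

  z o : Fin n
  z = enc 0#
  o = enc 1#

  -- An unknown is a tuple (x , p , q , t , u) with u ≢ z.  For x in J it is a
  -- coefficient of p in c(x), whatever q, t and u are.  For x = i it belongs to the
  -- relation (p , q) of row i, at the occurrence [p] if t ≡ z, at [q] if t ≡ o and
  -- at [p + q] otherwise.  If several tuples qualify, their values are added up.
  module Gadget (J : Fin n → Bool) (z≢o : z ≢ o) where

    pick : Fin n → K → K → K
    pick t r s = if does (t ≟ z) then r else (if does (t ≟ o) then s else r + s)

    relation : (K → K → K) → Fin n → Fin n → K
    relation f p q = onR (λ r → onR (f r) q) p

    weight : (i : Fin n) (a : Fin n → K) → Vec (Fin n) 5 → K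
    weight i a (x ∷ p ∷ q ∷ t ∷ u ∷ []) =
      ¬? (u ≟ z) ▸ (if J x then onR (a x *_) p else (x ≟ i ▸ relation (pick t) p q))

    weight-column : ∀ i a x → J x ≡ true → ∀ p q t u →
                    weight i a (x ∷ p ∷ q ∷ t ∷ u ∷ []) ≡ (¬? (u ≟ z) ▸ onR (a x *_) p)
    weight-column i a x Jx p q t u =
      cong (λ c → ¬? (u ≟ z) ▸ (if c then onR (a x *_) p else (x ≟ i ▸ relation (pick t) p q))) Jx

    weight-relation : ∀ i a → J i ≡ false → ∀ p q t u →
                      weight i a (i ∷ p ∷ q ∷ t ∷ u ∷ []) ≡ (¬? (u ≟ z) ▸ relation (pick t) p q)
    weight-relation i a Ji p q t u =
      trans (cong (λ c → ¬? (u ≟ z) ▸ (if c then onR (a i *_) p else (i ≟ i ▸ relation (pick t) p q))) Ji)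
            (▸-congʳ (¬? (u ≟ z)) (λ _ → ▸-yes (i ≟ i) refl))

    weight-other : ∀ i a x → J x ≡ false → x ≢ i → ∀ Y → weight i a (x ∷ Y) ≡ 0#
    weight-other i a x Jx x≢i (p ∷ q ∷ t ∷ u ∷ []) =
      trans (cong (λ c → ¬? (u ≟ z) ▸ (if c then onR (a x *_) p else (x ≟ i ▸ relation (pick t) p q))) Jx)
            (trans (▸-congʳ (¬? (u ≟ z)) (λ _ → ▸-no (x ≟ i) x≢i)) (▸-0# (¬? (u ≟ z))))

    -- The tie equations. All tags except `z` and `o` stand for [p + q]; leaving out `o` keeps [p]
    -- and [p + q], leaving out `z` keeps [q] and [p + q]. Hence the total value at [p + q] is minus
    -- the total value at [p], respectively at [q], and all coefficients are 1.
    Cancels : (k i : Fin n) → (Vec (Fin n) 5 → K) → Set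
    Cancels k i v = ∀ p q → sum (λ t → sum (λ u → ¬? (t ≟ k) ▸ ¬? (u ≟ z) ▸ v (i ∷ p ∷ q ∷ t ∷ u ∷ []))) ≡ 0#

    Balances : (i : Fin n) (a : Fin n → K) (b : K) → (Vec (Fin n) 5 → K) → Set
    Balances i a b v = ∀ s → s ≢ z → ∑V 5 (λ Y → enc (weight i a Y) ≟ s ▸ v Y) ≡ (enc b ≟ s ▸ 1#)

    -- `D` is abstract because it will be a matrix entry of the image, which is known only up to
    -- logical equivalence. Fixing the first three coordinates collapses three of the five
    -- summations.
    cancels-sum : ∀ {D : Vec (Fin n) 5 → Set} (d : ∀ Y → Dec (D Y)) (v : Vec (Fin n) 5 → K) k i p q →
                  (∀ x p′ q′ t u → D (x ∷ p′ ∷ q′ ∷ t ∷ u ∷ []) ⇔ (x ∷ p′ ∷ q′ ∷ [] ≡ i ∷ p ∷ q ∷ [] × t ≢ k × u ≢ z)) →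
                  ∑V 5 (λ Y → d Y ▸ v Y) ≡ sum (λ t → sum (λ u → ¬? (t ≟ k) ▸ ¬? (u ≟ z) ▸ v (i ∷ p ∷ q ∷ t ∷ u ∷ [])))
    cancels-sum {D} d v k i p q D⇔ = begin
      ∑V 5 (λ Y → d Y ▸ v Y)
        ≡⟨ sum-cong-≗ (λ x → sum-cong-≗ (λ p′ → sum-cong-≗ (λ q′ → pull x p′ q′))) ⟩
      ∑V 3 (λ X → X ≟V Y₀ ▸ sum (λ t → sum (λ u → f X t u)))
        ≡⟨ ∑V-δ 3 Y₀ (λ X → sum (λ t → sum (λ u → f X t u))) ⟩
      sum (λ t → sum (λ u → f Y₀ t u)) ∎
      where
      Y₀ : Vec (Fin n) 3
      Y₀ = i ∷ p ∷ q ∷ []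
      f : Vec (Fin n) 3 → Fin n → Fin n → K
      f X t u = ¬? (t ≟ k) ▸ ¬? (u ≟ z) ▸ v (X ++ t ∷ u ∷ [])
      split : ∀ x p′ q′ t u (e : Dec (x ∷ p′ ∷ q′ ∷ [] ≡ Y₀)) (e₁ : Dec (t ≡ k)) (e₂ : Dec (u ≡ z)) →
              let Y = x ∷ p′ ∷ q′ ∷ t ∷ u ∷ [] in (d Y ▸ v Y) ≡ (e ▸ ¬? e₁ ▸ ¬? e₂ ▸ v Y)
      split x p′ q′ t u (no ¬e≡) _ _ = ▸-no (d _) (λ dY → ¬e≡ (proj₁ (to (D⇔ x p′ q′ t u) dY)))
      split x p′ q′ t u (yes _) (yes t≡k) _ = ▸-no (d _) (λ dY → proj₁ (proj₂ (to (D⇔ x p′ q′ t u) dY)) t≡k)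
      split x p′ q′ t u (yes _) (no _) (yes u≡z) = ▸-no (d _) (λ dY → proj₂ (proj₂ (to (D⇔ x p′ q′ t u) dY)) u≡z)
      split x p′ q′ t u (yes e≡) (no t≢k) (no u≢z) = ▸-yes (d _) (from (D⇔ x p′ q′ t u) (e≡ , t≢k , u≢z))
      pull : ∀ x p′ q′ → let X = x ∷ p′ ∷ q′ ∷ [] in
             ∑V 2 (λ Y → d (X ++ Y) ▸ v (X ++ Y)) ≡ (X ≟V Y₀ ▸ sum (λ t → sum (λ u → f X t u)))
      pull x p′ q′ = let X = x ∷ p′ ∷ q′ ∷ [] in trans
        (sum-cong-≗ (λ t → sum-cong-≗ (λ u → split x p′ q′ t u (X ≟V Y₀) (t ≟ k) (u ≟ z))))
        (∑V-▸ 2 (X ≟V Y₀) (λ { (t ∷ u ∷ []) → f X t u }))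

    coeff : Vec (Fin n) 4 → K
    coeff (p ∷ q ∷ t ∷ u ∷ []) = ¬? (u ≟ z) ▸ onR id p

    -- The value c(x) recovered from the unknowns. No row enters into it, so all rows are solved by
    -- the same c.
    collect : (Vec (Fin n) 5 → K) → Fin n → K
    collect v x = ∑V 4 (λ Y → coeff Y * v (x ∷ Y))

    -- From the equations of one row to the equation over the ring

    module _ {i : Fin n} {a : Fin n → K} {b : K} {v : Vec (Fin n) 5 → K}
             (cancels₀ : Cancels o i v) (cancels₁ : Cancels z i v) (balances : Balances i a b v) where

      private
        w : Vec (Fin n) 5 → K
        w = weight i a

      expand : ∀ k (y : K) → ∑R (λ r → r * (enc k ≟ enc r ▸ y)) ≡ k * y
      expand k y = trans (∑R-cong (λ r → *-▸ (enc k ≟ enc r) r)) (∑R-δ k (_* y))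

      -- Multiply the equation at s by s and add up over s.
      weighted-sum : ∑V 5 (λ Y → w Y * v Y) ≡ b
      weighted-sum = begin
        ∑V 5 (λ Y → w Y * v Y)
          ≡⟨ ∑V-cong 5 (λ Y → sym (expand (w Y) (v Y))) ⟩
        ∑V 5 (λ Y → ∑R (λ r → r * (enc (w Y) ≟ enc r ▸ v Y)))
          ≡⟨ sym (∑V-comm 5 (λ p Y → onR (λ r → r * (enc (w Y) ≟ enc r ▸ v Y)) p)) ⟩
        sum (λ p → ∑V 5 (λ Y → onR (λ r → r * (enc (w Y) ≟ enc r ▸ v Y)) p))
          ≡⟨ sum-cong-≗ (λ p → trans (sym (onR-∑V 5 (λ r Y → r * (enc (w Y) ≟ enc r ▸ v Y)) p))
                                     (onR-cong p (λ r _ → balance r))) ⟩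
        ∑R (λ r → r * (enc b ≟ enc r ▸ 1#))
          ≡⟨ expand b 1# ⟩
        b * 1#
          ≡⟨ *-identityʳ b ⟩
        b ∎
        where
        balance : ∀ r → ∑V 5 (λ Y → r * (enc (w Y) ≟ enc r ▸ v Y)) ≡ r * (enc b ≟ enc r ▸ 1#)
        balance r with enc r ≟ z
        -- The dropped equation at 0 would be multiplied by 0, so nothing is lost without it.
        ... | yes r≡z rewrite enc-injective r≡z = trans (∑V-0 5 (λ Y → zeroˡ (enc (w Y) ≟ z ▸ v Y))) (sym (zeroˡ _))
        ... | no r≢z = trans (sym (*-distribˡ-∑V 5 r (λ Y → enc (w Y) ≟ enc r ▸ v Y))) (cong (r *_) (balances (enc r) r≢z))

      -- An occurrence at [p + q] counts once towards r and once towards s. Collected separately,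
      -- the coefficients of r and of s are the left-hand sides of the two tie equations, so the
      -- relations of a row contribute 0.
      pick-split : ∀ t r s y → pick t r s * y ≡ r * (¬? (t ≟ o) ▸ y) + s * (¬? (t ≟ z) ▸ y)
      pick-split t r s y with t ≟ z | t ≟ o
      ... | yes refl | yes z≡o = ⊥-elim (z≢o z≡o)
      ... | yes _    | no _    = sym (trans (cong (r * y +_) (zeroʳ s)) (+-identityʳ _))
      ... | no _     | yes _   = sym (trans (cong (_+ s * y) (zeroʳ r)) (+-identityˡ _))
      ... | no _     | no _    = distribʳ y r s

      relation-block : ∀ p q → sum (λ t → sum (λ u → (¬? (u ≟ z) ▸ relation (pick t) p q) * v (i ∷ p ∷ q ∷ t ∷ u ∷ []))) ≡ 0#
      relation-block p q with dec p | dec q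
      ... | nothing | _       = ∑-0 (λ t → ∑-0 (λ u → trans (cong (_* v (i ∷ p ∷ q ∷ t ∷ u ∷ [])) (▸-0# (¬? (u ≟ z)))) (zeroˡ _)))
      ... | just r  | nothing = ∑-0 (λ t → ∑-0 (λ u → trans (cong (_* v (i ∷ p ∷ q ∷ t ∷ u ∷ [])) (▸-0# (¬? (u ≟ z)))) (zeroˡ _)))
      ... | just r  | just s  = begin
        sum (λ t → sum (λ u → (¬? (u ≟ z) ▸ pick t r s) * y t u))
          ≡⟨ sum-cong-≗ (λ t → trans (sum-cong-≗ (λ u → split t u (u ≟ z))) (∑-distrib-+ (λ u → r * f t u) (λ u → s * g t u))) ⟩
        sum (λ t → sum (λ u → r * f t u) + sum (λ u → s * g t u))
          ≡⟨ ∑-distrib-+ (λ t → sum (λ u → r * f t u)) (λ t → sum (λ u → s * g t u)) ⟩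
        sum (λ t → sum (λ u → r * f t u)) + sum (λ t → sum (λ u → s * g t u))
          ≡⟨ cong₂ _+_ (factor r f) (factor s g) ⟩
        r * sum (λ t → sum (f t)) + s * sum (λ t → sum (g t))
          ≡⟨ cong₂ (λ k l → r * k + s * l) (cancels₀ p q) (cancels₁ p q) ⟩
        r * 0# + s * 0#
          ≡⟨ cong₂ _+_ (zeroʳ r) (zeroʳ s) ⟩
        0# + 0#
          ≡⟨ +-identityʳ 0# ⟩
        0# ∎
        where
        y f g : Fin n → Fin n → K
        y t u = v (i ∷ p ∷ q ∷ t ∷ u ∷ [])
        f t u = ¬? (t ≟ o) ▸ ¬? (u ≟ z) ▸ y t u
        g t u = ¬? (t ≟ z) ▸ ¬? (u ≟ z) ▸ y t u
        split : ∀ t u (d : Dec (u ≡ z)) → (¬? d ▸ pick t r s) * y t u ≡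
                r * (¬? (t ≟ o) ▸ ¬? d ▸ y t u) + s * (¬? (t ≟ z) ▸ ¬? d ▸ y t u)
        split t u (no _)  = pick-split t r s (y t u)
        split t u (yes _) = trans (zeroˡ _) (sym (trans (cong₂ _+_
          (trans (cong (r *_) (▸-0# (¬? (t ≟ o)))) (zeroʳ r)) (trans (cong (s *_) (▸-0# (¬? (t ≟ z)))) (zeroʳ s))) (+-identityʳ 0#)))
        factor : ∀ k (h : Fin n → Fin n → K) → sum (λ t → sum (λ u → k * h t u)) ≡ k * sum (λ t → sum (h t))
        factor k h = sym (trans (*-distribˡ-sum k (λ t → sum (h t))) (sum-cong-≗ (λ t → *-distribˡ-sum k (h t))))

      column-block : ∀ x → J x ≡ true → ∀ Y → a x * (coeff Y * v (x ∷ Y)) ≡ w (x ∷ Y) * v (x ∷ Y)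
      column-block x Jx Y@(p ∷ q ∷ t ∷ u ∷ []) =
        trans (sym (*-assoc (a x) (coeff Y) (v (x ∷ Y))))
              (cong (_* v (x ∷ Y)) (trans scale (sym (weight-column i a x Jx p q t u))))
        where
        pull : a x * onR id p ≡ onR (a x *_) p
        pull with dec p
        ... | just r  = refl
        ... | nothing = zeroʳ (a x)
        scale : a x * coeff Y ≡ (¬? (u ≟ z) ▸ onR (a x *_) p)
        scale = trans (*-▸ (¬? (u ≟ z)) (a x)) (▸-congʳ (¬? (u ≟ z)) (λ _ → pull))

      block : ∀ x c → J x ≡ c → ∑V 4 (λ Y → w (x ∷ Y) * v (x ∷ Y)) ≡ (if c then a x * collect v x else 0#)
      block x true  Jx = sym (trans (*-distribˡ-∑V 4 (a x) (λ Y → coeff Y * v (x ∷ Y))) (∑V-cong 4 (column-block x Jx)))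
      block x false Jx = other (x ≟ i)
        where
        other : Dec (x ≡ i) → ∑V 4 (λ Y → w (x ∷ Y) * v (x ∷ Y)) ≡ 0#
        other (yes refl) = ∑-0 (λ p → ∑-0 (λ q → trans
          (sum-cong-≗ (λ t → sum-cong-≗ (λ u → cong (_* v (i ∷ p ∷ q ∷ t ∷ u ∷ [])) (weight-relation i a Jx p q t u))))
          (relation-block p q)))
        other (no x≢i) = ∑V-0 4 (λ Y → trans (cong (_* v (x ∷ Y)) (weight-other i a x Jx x≢i Y)) (zeroˡ _))

      collect-solves : sum (λ x → if J x then a x * collect v x else 0#) ≡ b
      collect-solves = trans (sum-cong-≗ (λ x → sym (block x (J x) refl))) weighted-sum

    -- From a solution over the ring to the unknowns

    column-tuple : K → Vec (Fin n) 4
    column-tuple k = enc k ∷ z ∷ z ∷ o ∷ []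

    -- The multiple k of [r + s] - [r] - [s], spread over its three occurrences. The row element x
    -- itself is the tag of [r + s]: it lies outside R and so differs from `z` and `o`.
    relation-value : Fin n → Fin n → K → K
    relation-value x t k = ((t ≟ z ▸ - k) + (t ≟ o ▸ - k)) + (t ≟ x ▸ k)

    -- Among the tuples of equal weight one representative carries the value and the others get 0.
    -- The representative has u = `o`, which satisfies `u ≢ z`; for x in J its q and t are arbitrary
    -- choices.
    assign : (c : Fin n → K) (ζ : Fin n → K → K → K) → Vec (Fin n) 5 → K
    assign c ζ (x ∷ Y@(p ∷ q ∷ t ∷ u ∷ [])) =
      if J x then (Y ≟V column-tuple (c x) ▸ 1#) else (u ≟ o ▸ relation (λ r s → relation-value x t (ζ x r s)) p q)

    multiple-assign : ∀ {c ζ} → (∀ {k} → Multiple k → Multiple (- k)) → (∀ x r s → Multiple (ζ x r s)) →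
                      ∀ Y → Multiple (assign c ζ Y)
    multiple-assign {c} {ζ} multiple-− mζ (x ∷ Y@(p ∷ q ∷ t ∷ u ∷ [])) with J x
    ... | true  = multiple-▸ (Y ≟V column-tuple (c x)) multiple-1
    ... | false = multiple-▸ (u ≟ o) go
      where
      go : Multiple (relation (λ r s → relation-value x t (ζ x r s)) p q)
      go with dec p | dec q
      ... | nothing | _       = multiple-0
      ... | just r  | nothing = multiple-0
      ... | just r  | just s  = multiple-+ (multiple-+ (multiple-▸ (t ≟ z) (multiple-− (mζ x r s))) (multiple-▸ (t ≟ o) (multiple-− (mζ x r s))))
                                           (multiple-▸ (t ≟ x) (mζ x r s))

    -- `telescopes` says that the formal sum of the products a(x)c(x), corrected by the relations
    -- with coefficients `ζ i`, is [b] up to multiples of [0]. The condition φ(0) = 0 hides those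
    -- multiples, among them the summands [0] from x outside J.
    module _ {c : Fin n → K} {ζ : Fin n → K → K → K} {i : Fin n} {a : Fin n → K} {b : K}
             (Ji : J i ≡ false) (i≢z : i ≢ z) (i≢o : i ≢ o)
             (telescopes : ∀ φ → φ 0# ≡ 0# →
                sum (λ x → φ (if J x then a x * c x else 0#)) + ∑R (λ r → ∑R (λ s → ζ i r s * Δ φ r s)) ≡ φ b)
             where

      private
        v : Vec (Fin n) 5 → K
        v = assign c ζ
        w : Vec (Fin n) 5 → K
        w = weight i a
        value : Fin n → Fin n → Fin n → K
        value p q t = relation (λ r s → relation-value i t (ζ i r s)) p q

      assign-relation : ∀ p q t u → v (i ∷ p ∷ q ∷ t ∷ u ∷ []) ≡ (u ≟ o ▸ value p q t)
      assign-relation p q t u =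
        cong (λ d → if d then ((p ∷ q ∷ t ∷ u ∷ []) ≟V column-tuple (c i) ▸ 1#) else (u ≟ o ▸ value p q t)) Ji

      o≢z : o ≢ z
      o≢z o≡z = z≢o (sym o≡z)

      ∑-cancel : ∀ j k → sum (λ t → (t ≟ j ▸ - k) + (t ≟ i ▸ k)) ≡ 0#
      ∑-cancel j k = trans (∑-distrib-+ (λ t → t ≟ j ▸ - k) (λ t → t ≟ i ▸ k))
                           (trans (cong₂ _+_ (∑-δ j (λ _ → - k)) (∑-δ i (λ _ → k))) (-‿inverseˡ k))

      assign-cancels : ∀ k → (∀ y → sum (λ t → ¬? (t ≟ k) ▸ relation-value i t y) ≡ 0#) → Cancels k i v
      assign-cancels k cancel p q = begin
        sum (λ t → sum (λ u → ¬? (t ≟ k) ▸ ¬? (u ≟ z) ▸ v (i ∷ p ∷ q ∷ t ∷ u ∷ [])))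
          ≡⟨ sum-cong-≗ (λ t → trans (sum-cong-≗ (λ u → at-o t u (t ≟ k))) (∑-δ o (λ _ → ¬? (t ≟ k) ▸ value p q t))) ⟩
        sum (λ t → ¬? (t ≟ k) ▸ value p q t)
          ≡⟨ cancel-value ⟩
        0# ∎
        where
        at-o : ∀ t u (d : Dec (t ≡ k)) → (¬? d ▸ ¬? (u ≟ z) ▸ v (i ∷ p ∷ q ∷ t ∷ u ∷ [])) ≡ (u ≟ o ▸ ¬? d ▸ value p q t)
        at-o t u (yes _) = sym (▸-0# (u ≟ o))
        at-o t u (no _)  = trans (▸-congʳ (¬? (u ≟ z)) (λ _ → assign-relation p q t u)) (absorb (u ≟ z) (u ≟ o))
          where
          absorb : (d : Dec (u ≡ z)) (e : Dec (u ≡ o)) → (¬? d ▸ e ▸ value p q t) ≡ (e ▸ value p q t)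
          absorb (no _)    e        = refl
          absorb (yes _)   (no _)   = refl
          absorb (yes u≡z) (yes u≡o) = ⊥-elim (z≢o (trans (sym u≡z) u≡o))
        cancel-value : sum (λ t → ¬? (t ≟ k) ▸ value p q t) ≡ 0#
        cancel-value with dec p | dec q
        ... | nothing | _       = ∑-0 (λ t → ▸-0# (¬? (t ≟ k)))
        ... | just r  | nothing = ∑-0 (λ t → ▸-0# (¬? (t ≟ k)))
        ... | just r  | just s  = cancel (ζ i r s)

      assign-cancels₀ : Cancels o i v
      assign-cancels₀ = assign-cancels o (λ y → trans (sum-cong-≗ (λ t → drop t y (t ≟ z) (t ≟ o) (t ≟ i))) (∑-cancel z y))
        where
        drop : ∀ t y (d : Dec (t ≡ z)) (e : Dec (t ≡ o)) (f : Dec (t ≡ i)) →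
               (¬? e ▸ ((d ▸ - y) + (e ▸ - y)) + (f ▸ y)) ≡ (d ▸ - y) + (f ▸ y)
        drop t y d (no _) f = cong (_+ (f ▸ y)) (+-identityʳ _)
        drop t y (yes t≡z) (yes t≡o) f = ⊥-elim (z≢o (trans (sym t≡z) t≡o))
        drop t y (no _) (yes t≡o) (yes t≡i) = ⊥-elim (i≢o (trans (sym t≡i) t≡o))
        drop t y (no _) (yes _) (no _) = sym (+-identityʳ 0#)

      assign-cancels₁ : Cancels z i v
      assign-cancels₁ = assign-cancels z (λ y → trans (sum-cong-≗ (λ t → drop t y (t ≟ z) (t ≟ o) (t ≟ i))) (∑-cancel o y))
        where
        drop : ∀ t y (d : Dec (t ≡ z)) (e : Dec (t ≡ o)) (f : Dec (t ≡ i)) →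
               (¬? d ▸ ((d ▸ - y) + (e ▸ - y)) + (f ▸ y)) ≡ (e ▸ - y) + (f ▸ y)
        drop t y (no _) e f = cong (_+ (f ▸ y)) (+-identityˡ _)
        drop t y (yes t≡z) (yes t≡o) f = ⊥-elim (z≢o (trans (sym t≡z) t≡o))
        drop t y (yes t≡z) (no _) (yes t≡i) = ⊥-elim (i≢z (trans (sym t≡i) t≡z))
        drop t y (yes _) (no _) (no _) = sym (+-identityʳ 0#)

      module _ (φ : K → K) (φ0 : φ 0# ≡ 0#) where

        private
          Z : K
          Z = ∑R (λ r → ∑R (λ s → ζ i r s * Δ φ r s))

        ∑-relation : ∀ r s k → sum (λ t → φ (pick t r s) * relation-value i t k) ≡ k * Δ φ r s
        ∑-relation r s k = begin
          sum (λ t → φ (pick t r s) * relation-value i t k)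
            ≡⟨ sum-cong-≗ (λ t → split t (t ≟ z) (t ≟ o) (t ≟ i)) ⟩
          sum (λ t → ((t ≟ z ▸ A) + (t ≟ o ▸ B)) + (t ≟ i ▸ C))
            ≡⟨ ∑-distrib-+ (λ t → (t ≟ z ▸ A) + (t ≟ o ▸ B)) (λ t → t ≟ i ▸ C) ⟩
          sum (λ t → (t ≟ z ▸ A) + (t ≟ o ▸ B)) + sum (λ t → t ≟ i ▸ C)
            ≡⟨ cong₂ _+_ (∑-distrib-+ (λ t → t ≟ z ▸ A) (λ t → t ≟ o ▸ B)) (∑-δ i (λ _ → C)) ⟩
          (sum (λ t → t ≟ z ▸ A) + sum (λ t → t ≟ o ▸ B)) + C
            ≡⟨ cong (_+ C) (cong₂ _+_ (∑-δ z (λ _ → A)) (∑-δ o (λ _ → B))) ⟩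
          (A + B) + C
            ≡⟨ cong (_+ C) (sym (distribʳ (- k) (φ r) (φ s))) ⟩
          (φ r + φ s) * - k + φ (r + s) * k
            ≡⟨ +-comm _ _ ⟩
          φ (r + s) * k + (φ r + φ s) * - k
            ≡⟨ cong₂ _+_ (*-comm _ k) (trans (sym (-‿distribʳ-* _ k)) (trans (cong -_ (*-comm _ k)) (-‿distribʳ-* k _))) ⟩
          k * φ (r + s) + k * - (φ r + φ s)
            ≡⟨ sym (distribˡ k _ _) ⟩
          k * Δ φ r s ∎
          where
          A B C : K
          A = φ r * - k
          B = φ s * - k
          C = φ (r + s) * k
          split : ∀ t (d : Dec (t ≡ z)) (e : Dec (t ≡ o)) (f : Dec (t ≡ i)) →
                  φ (if does d then r else (if does e then s else r + s)) * (((d ▸ - k) + (e ▸ - k)) + (f ▸ k)) ≡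
                  ((d ▸ A) + (e ▸ B)) + (f ▸ C)
          split t (yes t≡z) (yes t≡o) _ = ⊥-elim (z≢o (trans (sym t≡z) t≡o))
          split t (yes t≡z) _ (yes t≡i) = ⊥-elim (i≢z (trans (sym t≡i) t≡z))
          split t _ (yes t≡o) (yes t≡i) = ⊥-elim (i≢o (trans (sym t≡i) t≡o))
          split t (yes _) (no _) (no _) = trans (cong (φ r *_) (trans (+-identityʳ _) (+-identityʳ _))) (sym (trans (+-identityʳ _) (+-identityʳ _)))
          split t (no _) (yes _) (no _) = trans (cong (φ s *_) (trans (+-identityʳ _) (+-identityˡ _))) (sym (trans (+-identityʳ _) (+-identityˡ _)))
          split t (no _) (no _) (yes _) = trans (cong (φ (r + s) *_) (trans (cong (_+ k) (+-identityʳ 0#)) (+-identityˡ _)))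
                                                (sym (trans (cong (_+ C) (+-identityʳ 0#)) (+-identityˡ _)))
          split t (no _) (no _) (no _) = trans (cong (φ (r + s) *_) zeros) (trans (zeroʳ _) (sym zeros))
            where
            zeros : (0# + 0#) + 0# ≡ 0#
            zeros = trans (+-identityʳ _) (+-identityʳ 0#)

        relation-blocks : ∑V 4 (λ Y → φ (w (i ∷ Y)) * v (i ∷ Y)) ≡ Z
        relation-blocks = sum-cong-≗ (λ p → trans (sum-cong-≗ (λ q → trans (sum-cong-≗ (λ t → at-o p q t)) (∑t p q))) (∑q p))
          where
          at-o : ∀ p q t → sum (λ u → φ (w (i ∷ p ∷ q ∷ t ∷ u ∷ [])) * v (i ∷ p ∷ q ∷ t ∷ u ∷ [])) ≡
                 φ (relation (pick t) p q) * value p q t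
          at-o p q t = trans (sum-cong-≗ (λ u → trans
                 (cong₂ (λ k l → φ k * l) (weight-relation i a Ji p q t u) (assign-relation p q t u)) (absorb u (u ≟ z) (u ≟ o))))
                 (∑-δ o (λ _ → φ (relation (pick t) p q) * value p q t))
            where
            absorb : ∀ u (d : Dec (u ≡ z)) (e : Dec (u ≡ o)) →
                     φ (¬? d ▸ relation (pick t) p q) * (e ▸ value p q t) ≡ (e ▸ φ (relation (pick t) p q) * value p q t)
            absorb u (yes u≡z) (yes u≡o) = ⊥-elim (z≢o (trans (sym u≡z) u≡o))
            absorb u (yes _)   (no _)    = zeroʳ _
            absorb u (no _)    e         = *-▸ e _
          ∑t : ∀ p q → sum (λ t → φ (relation (pick t) p q) * value p q t) ≡ relation (λ r s → ζ i r s * Δ φ r s) p q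
          ∑t p q with dec p | dec q
          ... | nothing | _       = ∑-0 {n} (λ t → zeroʳ (φ 0#))
          ... | just r  | nothing = ∑-0 {n} (λ t → zeroʳ (φ 0#))
          ... | just r  | just s  = ∑-relation r s (ζ i r s)
          ∑q : ∀ p → sum (λ q → relation (λ r s → ζ i r s * Δ φ r s) p q) ≡ onR (λ r → ∑R (λ s → ζ i r s * Δ φ r s)) p
          ∑q p with dec p
          ... | nothing = ∑-0 {n} (λ _ → refl)
          ... | just r  = refl

        assign-block : ∀ x d → J x ≡ d → ∑V 4 (λ Y → φ (w (x ∷ Y)) * v (x ∷ Y)) ≡ φ (if d then a x * c x else 0#) + (x ≟ i ▸ Z)
        assign-block x true Jx = begin
          ∑V 4 (λ Y → φ (w (x ∷ Y)) * v (x ∷ Y))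
            ≡⟨ ∑V-cong 4 at-tuple ⟩
          ∑V 4 (λ Y → Y ≟V column-tuple (c x) ▸ φ (a x * c x))
            ≡⟨ ∑V-δ 4 (column-tuple (c x)) (λ _ → φ (a x * c x)) ⟩
          φ (a x * c x)
            ≡⟨ sym (trans (cong (φ (a x * c x) +_) (▸-no (x ≟ i) x≢i)) (+-identityʳ _)) ⟩
          φ (a x * c x) + (x ≟ i ▸ Z) ∎
          where
          x≢i : x ≢ i
          x≢i refl with trans (sym Jx) Ji
          ... | ()
          at-tuple : ∀ Y → φ (w (x ∷ Y)) * v (x ∷ Y) ≡ (Y ≟V column-tuple (c x) ▸ φ (a x * c x))
          at-tuple Y@(p ∷ q ∷ t ∷ u ∷ []) = trans (cong₂ (λ k l → φ k * l) (weight-column i a x Jx p q t u)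
              (cong (λ d → if d then (Y ≟V column-tuple (c x) ▸ 1#) else (u ≟ o ▸ relation (λ r s → relation-value x t (ζ x r s)) p q)) Jx))
            (trans (*-▸ (Y ≟V column-tuple (c x)) _) (▸-congʳ (Y ≟V column-tuple (c x)) value-at))
            where
            value-at : Y ≡ column-tuple (c x) → φ (¬? (u ≟ z) ▸ onR (a x *_) p) * 1# ≡ φ (a x * c x)
            value-at refl = trans (*-identityʳ _) (cong φ (trans (▸-yes (¬? (o ≟ z)) o≢z) (onR-enc (a x *_) (c x))))
        assign-block x false Jx = other (x ≟ i)
          where
          other : (d : Dec (x ≡ i)) → ∑V 4 (λ Y → φ (w (x ∷ Y)) * v (x ∷ Y)) ≡ φ 0# + (d ▸ Z)
          other (yes refl) = trans relation-blocks (sym (trans (cong (_+ Z) φ0) (+-identityˡ Z)))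
          other (no x≢i) = trans (∑V-0 4 (λ Y → trans (cong (_* v (x ∷ Y)) (trans (cong φ (weight-other i a x Jx x≢i Y)) φ0)) (zeroˡ _)))
                                 (sym (trans (+-identityʳ _) φ0))

        assign-sum : ∑V 5 (λ Y → φ (w Y) * v Y) ≡ φ b
        assign-sum = begin
          sum (λ x → ∑V 4 (λ Y → φ (w (x ∷ Y)) * v (x ∷ Y)))
            ≡⟨ sum-cong-≗ (λ x → assign-block x (J x) refl) ⟩
          sum (λ x → φ (if J x then a x * c x else 0#) + (x ≟ i ▸ Z))
            ≡⟨ ∑-distrib-+ (λ x → φ (if J x then a x * c x else 0#)) (λ x → x ≟ i ▸ Z) ⟩
          sum (λ x → φ (if J x then a x * c x else 0#)) + sum (λ x → x ≟ i ▸ Z)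
            ≡⟨ cong (sum (λ x → φ (if J x then a x * c x else 0#)) +_) (∑-δ i (λ _ → Z)) ⟩
          sum (λ x → φ (if J x then a x * c x else 0#)) + Z
            ≡⟨ telescopes φ φ0 ⟩
          φ b ∎

      -- The coefficient of [s] is read off by the indicator of s. It is an admissible test function
      -- because `s ≢ z` makes it vanish at 0.
      assign-balances : Balances i a b v
      assign-balances s s≢z = trans (∑V-cong 5 (λ Y → as-* (enc (w Y) ≟ s) (v Y)))
                                    (assign-sum (λ r → enc r ≟ s ▸ 1#) (▸-no (enc 0# ≟ s) (λ z≡s → s≢z (sym z≡s))))
        where
        as-* : (d : Dec P) (k : K) → (d ▸ k) ≡ (d ▸ 1#) * k
        as-* (yes _) k = sym (*-identityˡ k)
        as-* (no _)  k = sym (zeroˡ k)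

-- Well-formed input systems

pattern v0 = var zero
pattern v1 = var (suc zero)
pattern v2 = var (suc (suc zero))
pattern v3 = var (suc (suc (suc zero)))
pattern v4 = var (suc (suc (suc (suc zero))))
pattern v5 = var (suc (suc (suc (suc (suc zero)))))
pattern v6 = var (suc (suc (suc (suc (suc (suc zero))))))

oneᵗ zerᵗ : ∀ {v} → Term τr≤ v
oneᵗ = con zero
zerᵗ = con (suc zero)

shift : ∀ {σ v} → Term σ v → Term σ (suc v)
shift (var i) = var (suc i)
shift (con c) = con c

Rᵈ : ∀ {v} → Term τr≤ v → Definable τr≤ v
Rᵈ x = atomᵈ zero (x ∷ [])

Aᵈ plusᵈ timesᵈ : ∀ {v} → Term τr≤ v → Term τr≤ v → Term τr≤ v → Definable τr≤ v
Aᵈ x y r = atomᵈ (suc zero) (x ∷ y ∷ r ∷ [])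
plusᵈ x y z = atomᵈ (suc (suc (suc zero))) (x ∷ y ∷ z ∷ [])
timesᵈ x y z = atomᵈ (suc (suc (suc (suc zero)))) (x ∷ y ∷ z ∷ [])

bᵈ leqᵈ : ∀ {v} → Term τr≤ v → Term τr≤ v → Definable τr≤ v
bᵈ x r = atomᵈ (suc (suc zero)) (x ∷ r ∷ [])
leqᵈ x y = atomᵈ (suc (suc (suc (suc (suc zero))))) (x ∷ y ∷ [])

Iᵈ Jᵈ : ∀ {v} → Term τr≤ v → Definable τr≤ v
Iᵈ x = ∼ Rᵈ x ⊓ ∃ᵈ (bᵈ (shift x) v0)
Jᵈ x = ∼ Rᵈ x ⊓ ∼ ∃ᵈ (bᵈ (shift x) v0)

Ternary : Set₁
Ternary = ∀ {v} → Term τr≤ v → Term τr≤ v → Term τr≤ v → Definable τr≤ v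

∀² ∀³ ∀⁴ : ∀ {v} → Definable τr≤ _ → Definable τr≤ v
∀² {v} P = ∀ᵈ {v = v} (∀ᵈ P)
∀³ {v} P = ∀ᵈ {v = v} (∀² P)
∀⁴ {v} P = ∀ᵈ {v = v} (∀³ P)

-- Only graphs are available, so an identity quantifies over the values of all its subterms. It
-- would hold vacuously at undefined values; the totality clause of `operationᵈ` rules these out.
operationᵈ associativeᵈ commutativeᵈ : Ternary → ∀ {v} → Definable τr≤ v
operationᵈ f = ∀³ (f v2 v1 v0 ⇛ Rᵈ v2 ⊓ Rᵈ v1 ⊓ Rᵈ v0)
             ⊓ ∀² (Rᵈ v1 ⇛ Rᵈ v0 ⇛ ∃ᵈ (f v2 v1 v0))
             ⊓ ∀⁴ (f v3 v2 v1 ⇛ f v3 v2 v0 ⇛ v1 ≐ v0)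
associativeᵈ f = ∀³ (∀³ (f v5 v4 v2 ⇛ f v2 v3 v1 ⇛ f v4 v3 v0 ⇛ f v5 v0 v1))
commutativeᵈ f = ∀³ (f v2 v1 v0 ⇛ f v1 v2 v0)

identityᵈ : Ternary → (∀ {v} → Term τr≤ v) → ∀ {v} → Definable τr≤ v
identityᵈ f e = ∀ᵈ (Rᵈ v0 ⇛ f e v0 v0)

ringᵈ orderᵈ systemᵈ validᵈ : ∀ {v} → Definable τr≤ v
ringᵈ = Rᵈ oneᵗ ⊓ Rᵈ zerᵗ
      ⊓ operationᵈ plusᵈ ⊓ operationᵈ timesᵈ
      ⊓ associativeᵈ plusᵈ ⊓ commutativeᵈ plusᵈ ⊓ identityᵈ plusᵈ zerᵗ
      ⊓ ∀ᵈ (Rᵈ v0 ⇛ ∃ᵈ (plusᵈ v1 v0 zerᵗ))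
      ⊓ associativeᵈ timesᵈ ⊓ commutativeᵈ timesᵈ ⊓ identityᵈ timesᵈ oneᵗ
      ⊓ ∀³ (∀⁴ (plusᵈ v5 v4 v3 ⇛ timesᵈ v6 v3 v2 ⇛ timesᵈ v6 v5 v1 ⇛ timesᵈ v6 v4 v0 ⇛ plusᵈ v1 v0 v2))
orderᵈ = ∀² (leqᵈ v1 v0 ⇛ Rᵈ v1 ⊓ Rᵈ v0)
       ⊓ ∀ᵈ (Rᵈ v0 ⇛ leqᵈ v0 v0)
       ⊓ ∀² (leqᵈ v1 v0 ⇛ leqᵈ v0 v1 ⇛ v1 ≐ v0)
       ⊓ ∀³ (leqᵈ v2 v1 ⇛ leqᵈ v1 v0 ⇛ leqᵈ v2 v0)
       ⊓ ∀² (Rᵈ v1 ⇛ Rᵈ v0 ⇛ leqᵈ v1 v0 ⊔ leqᵈ v0 v1)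
systemᵈ = ∀² (bᵈ v1 v0 ⇛ ∼ Rᵈ v1 ⊓ Rᵈ v0)
        ⊓ ∀³ (bᵈ v2 v1 ⇛ bᵈ v2 v0 ⇛ v1 ≐ v0)
        ⊓ ∀³ (Aᵈ v2 v1 v0 ⇛ Iᵈ v2 ⊓ Jᵈ v1 ⊓ Rᵈ v0)
        ⊓ ∀² (Iᵈ v1 ⇛ Jᵈ v0 ⇛ ∃ᵈ (Aᵈ v2 v1 v0))
        ⊓ ∀⁴ (Aᵈ v3 v2 v1 ⇛ Aᵈ v3 v2 v0 ⇛ v1 ≐ v0)
validᵈ = ringᵈ ⊓ orderᵈ ⊓ systemᵈ

-- SolveCR≤ without the solution, which is its first-order part.
record System (S : Struct τr≤) : Set where
  open LesR S
  field
    add mul   : Fin n → Fin n → Fin n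
    graph+    : ∀ x y z → T (plus x y z) ⇔ (IsR x × IsR y × z ≡ add x y)
    graph·    : ∀ x y z → T (times x y z) ⇔ (IsR x × IsR y × z ≡ mul x y)
    closed+   : ∀ x y → IsR x → IsR y → IsR (add x y)
    closed·   : ∀ x y → IsR x → IsR y → IsR (mul x y)
    one∈R     : IsR one
    zer∈R     : IsR zer
    +-assoc   : ∀ x y z → IsR x → IsR y → IsR z → add (add x y) z ≡ add x (add y z)
    +-comm    : ∀ x y → IsR x → IsR y → add x y ≡ add y x
    +-ident   : ∀ x → IsR x → add zer x ≡ x
    +-inverse : ∀ x → IsR x → ∃ λ y → IsR y × add x y ≡ zer
    ·-assoc   : ∀ x y z → IsR x → IsR y → IsR z → mul (mul x y) z ≡ mul x (mul y z)
    ·-comm    : ∀ x y → IsR x → IsR y → mul x y ≡ mul y x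
    ·-ident   : ∀ x → IsR x → mul one x ≡ x
    distrib   : ∀ x y z → IsR x → IsR y → IsR z → mul x (add y z) ≡ add (mul x y) (mul x z)
    ≤-shape   : ∀ x y → T (leq x y) → IsR x × IsR y
    ≤-refl    : ∀ x → IsR x → T (leq x x)
    ≤-antisym : ∀ x y → T (leq x y) → T (leq y x) → x ≡ y
    ≤-trans   : ∀ x y z → T (leq x y) → T (leq y z) → T (leq x z)
    ≤-total   : ∀ x y → IsR x → IsR y → T (leq x y) ⊎ T (leq y x)
    b-shape   : ∀ x r → T (bb x r) → ¬ IsR x × IsR r
    b-fun     : ∀ x r r′ → T (bb x r) → T (bb x r′) → r ≡ r′
    entry     : Fin n → Fin n → Fin n
    A-graph   : ∀ x y r → T (Ab x y r) ⇔ (T (isI x) × T (isJ y) × r ≡ entry x y)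
    entry∈R   : ∀ x y → T (isI x) → T (isJ y) → IsR (entry x y)

system : ∀ {S} → SolveCR≤ S → System S
system s = record { SolveCR≤ s }

-- First-order validity and the operations it determines

module _ (S : Struct τr≤) where
  open LesR S

  T-isI : ∀ {x} → T (isI x) ⇔ (¬ IsR x × ∃ (T ∘ bb x))
  T-isI = mk⇔ (λ h → let p , q = to T-∧ h in to T-not p , to (T-any _) q)
              (λ (p , q) → from T-∧ (from T-not p , from (T-any _) q))

  T-isJ : ∀ {x} → T (isJ x) ⇔ (¬ IsR x × ¬ ∃ (T ∘ bb x))
  T-isJ = mk⇔ (λ h → let p , q = to T-∧ h in to T-not p , to T-not q ∘ from (T-any _))
              (λ (p , q) → from T-∧ (from T-not p , from T-not (q ∘ to (T-any _))))

  Graph : (Fin n → Fin n → Fin n → Bool) → (P Q : Fin n → Set) → (Fin n → Fin n → Fin n) → Set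
  Graph g P Q f = ∀ x y z → T (g x y z) ⇔ (P x × Q y × z ≡ f x y)

  -- The domains `P` and `Q` are parameters so that addition and multiplication on R and the matrix
  -- on I × J are all instances.
  IsOperation : (Fin n → Fin n → Fin n → Bool) → (P Q : Fin n → Set) → Set
  IsOperation g P Q = (∀ x y z → T (g x y z) → P x × Q y × IsR z)
                    × (∀ x y → P x → Q y → ∃ λ z → T (g x y z))
                    × (∀ x y z z′ → T (g x y z) → T (g x y z′) → z ≡ z′)

  module _ {g : Fin n → Fin n → Fin n → Bool} {P Q : Fin n → Set} where

    operation→graph : IsOperation g P Q → ∃ λ f → Graph g P Q f × (∀ x y → P x → Q y → IsR (f x y))
    operation→graph (shape , total , functional) = f , graph , closed
      where
      f : Fin n → Fin n → Fin n
      f x y with any? (λ z → T? (g x y z))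
      ... | yes (z , _) = z
      ... | no _        = zer
      value : ∀ x y → P x → Q y → T (g x y (f x y))
      value x y px qy with any? (λ z → T? (g x y z))
      ... | yes (_ , gz) = gz
      ... | no ¬g        = contradiction (total x y px qy) ¬g
      graph : Graph g P Q f
      graph x y z = mk⇔
        (λ gz → let px , qy , _ = shape x y z gz in px , qy , functional x y z (f x y) gz (value x y px qy))
        (λ { (px , qy , refl) → value x y px qy })
      closed : ∀ x y → P x → Q y → IsR (f x y)
      closed x y px qy = proj₂ (proj₂ (shape x y (f x y) (value x y px qy)))

    graph→operation : ∀ {f} → Graph g P Q f → (∀ x y → P x → Q y → IsR (f x y)) → IsOperation g P Q
    graph→operation {f} graph closed =
        (λ x y z gz → let px , qy , z≡ = to (graph x y z) gz in px , qy , subst IsR (sym z≡) (closed x y px qy))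
      , (λ x y px qy → f x y , from (graph x y _) (px , qy , refl))
      , (λ x y z z′ gz gz′ → trans (proj₂ (proj₂ (to (graph x y z) gz))) (sym (proj₂ (proj₂ (to (graph x y z′) gz′)))))

  valid→system : ∀ {v e} → Holds (validᵈ {v}) S e → System S
  valid→system ((one∈R , zer∈R , op+ , op· , +-assoc , +-comm , +-ident , +-inverse , ·-assoc , ·-comm , ·-ident , distrib) ,
                (≤-shape , ≤-refl , ≤-antisym , ≤-trans , ≤-total) ,
                (b-shape , b-fun , A-shape , A-total , A-fun))
    with operation→graph {P = IsR} {IsR} op+ | operation→graph {P = IsR} {IsR} op·
       | operation→graph {P = T ∘ isI} {T ∘ isJ}
           ( (λ x y r a → let i , j , r∈R = A-shape x y r a in from T-isI i , from T-isJ j , r∈R)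
           , (λ x y i j → A-total x y (to T-isI i) (to T-isJ j)) , A-fun )
  ... | add , graph+ , closed+ | mul , graph· , closed· | entry , A-graph , entry∈R = record
    { add = add ; mul = mul ; graph+ = graph+ ; graph· = graph· ; closed+ = closed+ ; closed· = closed·
    ; one∈R = one∈R ; zer∈R = zer∈R
    ; +-assoc = λ x y z rx ry rz → value+ (+-assoc x y z _ _ _
        (sum rx ry) (sum (closed+ x y rx ry) rz) (sum ry rz))
    ; +-comm = λ x y rx ry → value+ (+-comm x y _ (sum rx ry))
    ; +-ident = λ x rx → sym (value+ (+-ident x rx))
    ; +-inverse = λ x rx → let y , p = +-inverse x rx in
        y , proj₁ (proj₂ (to (graph+ x y zer) p)) , sym (value+ p)
    ; ·-assoc = λ x y z rx ry rz → value· (·-assoc x y z _ _ _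
        (product rx ry) (product (closed· x y rx ry) rz) (product ry rz))
    ; ·-comm = λ x y rx ry → value· (·-comm x y _ (product rx ry))
    ; ·-ident = λ x rx → sym (value· (·-ident x rx))
    ; distrib = λ x y z rx ry rz → value+ (distrib x y z _ _ _ _
        (sum ry rz) (product rx (closed+ y z ry rz)) (product rx ry) (product rx rz))
    ; ≤-shape = ≤-shape ; ≤-refl = ≤-refl ; ≤-antisym = ≤-antisym ; ≤-trans = ≤-trans ; ≤-total = ≤-total
    ; b-shape = b-shape ; b-fun = b-fun ; entry = entry ; A-graph = A-graph ; entry∈R = entry∈R }
    where
    sum : ∀ {x y} → IsR x → IsR y → T (plus x y (add x y))
    sum rx ry = from (graph+ _ _ _) (rx , ry , refl)
    product : ∀ {x y} → IsR x → IsR y → T (times x y (mul x y))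
    product rx ry = from (graph· _ _ _) (rx , ry , refl)
    value+ : ∀ {x y z} → T (plus x y z) → z ≡ add x y
    value+ p = proj₂ (proj₂ (to (graph+ _ _ _) p))
    value· : ∀ {x y z} → T (times x y z) → z ≡ mul x y
    value· p = proj₂ (proj₂ (to (graph· _ _ _) p))

  system→valid : System S → ∀ {v e} → Holds (validᵈ {v}) S e
  system→valid s =
    ( one∈R , zer∈R , graph→operation graph+ closed+ , graph→operation graph· closed·
    , associative graph+ closed+ +-assoc , commutative graph+ +-comm , (λ x rx → from (graph+ zer x x) (zer∈R , rx , sym (+-ident x rx)))
    , (λ x rx → let y , ry , x+y≡0 = +-inverse x rx in y , from (graph+ x y zer) (rx , ry , sym x+y≡0))
    , associative graph· closed· ·-assoc , commutative graph· ·-comm , (λ x rx → from (graph· one x x) (one∈R , rx , sym (·-ident x rx)))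
    , distributive ) ,
    (≤-shape , ≤-refl , ≤-antisym , ≤-trans , ≤-total) ,
    ( b-shape , b-fun
    , (λ x y r a → let i , j , r≡ = to (A-graph x y r) a in
        to T-isI i , to T-isJ j , subst IsR (sym r≡) (entry∈R x y i j))
    , (λ x y i j → entry x y , from (A-graph x y _) (from T-isI i , from T-isJ j , refl))
    , (λ x y r r′ a a′ → trans (proj₂ (proj₂ (to (A-graph x y r) a))) (sym (proj₂ (proj₂ (to (A-graph x y r′) a′))))) )
    where
    open System s

    associative : ∀ {g f} → Graph g IsR IsR f → (∀ x y → IsR x → IsR y → IsR (f x y)) →
                  (∀ x y z → IsR x → IsR y → IsR z → f (f x y) z ≡ f x (f y z)) →
                  ∀ x y z a b c → T (g x y a) → T (g a z b) → T (g y z c) → T (g x c b)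
    associative graph closed assoc x y z a b c xy az yz
      with to (graph x y a) xy | to (graph a z b) az | to (graph y z c) yz
    ... | rx , ry , refl | _ , rz , refl | _ , _ , refl = from (graph _ _ _) (rx , closed y z ry rz , assoc x y z rx ry rz)

    commutative : ∀ {g f} → Graph g IsR IsR f → (∀ x y → IsR x → IsR y → f x y ≡ f y x) →
                  ∀ x y a → T (g x y a) → T (g y x a)
    commutative graph comm x y a xy with to (graph x y a) xy
    ... | rx , ry , refl = from (graph _ _ _) (ry , rx , comm x y rx ry)

    distributive : ∀ x y z a b c d → T (plus y z a) → T (times x a b) → T (times x y c) → T (times x z d) → T (plus c d b)
    distributive x y z a b c d yz xa xy xz
      with to (graph+ y z a) yz | to (graph· x a b) xa | to (graph· x y c) xy | to (graph· x z d) xz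
    ... | ry , rz , refl | rx , _ , refl | _ , _ , refl | _ , _ , refl =
      from (graph+ _ _ _) (closed· x y rx ry , closed· x z rx rz , distrib x y z rx ry rz)

-- The interpretation

cyclic-step : ∀ {v} → Formula τr≤ (1 ∷ []) (suc v)
cyclic-step = or (eq v0 zerᵗ) (ex (and (rvar here (v0 ∷ [])) (atom (suc (suc (suc zero))) (oneᵗ ∷ v0 ∷ v1 ∷ []))))

-- The meaning is left as satisfaction: its description by multiples of 1 makes sense only once the
-- structure is known to be a system.
cyclicᵈ : ∀ {v} → Term τr≤ v → Definable τr≤ v
cyclicᵈ t = record
  { formula = ifp 1 cyclic-step (t ∷ [])
  ; Holds   = λ A e → Sat A (ifp 1 cyclic-step (t ∷ [])) e
  ; correct = λ A e → mk⇔ id id }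

-- The ring of a system and its definable cyclic subgroup

module SystemRing {S : Struct τr≤} (s : System S) where
  open LesR S public
  open System s public

  K : Set
  K = Σ (Fin n) IsR

  K-≡ : {k l : K} → proj₁ k ≡ proj₁ l → k ≡ l
  K-≡ {x , p} {.x , q} refl = cong (x ,_) (T-irrelevant p q)

  _⊕_ _⊗_ : K → K → K
  (x , p) ⊕ (y , q) = add x y , closed+ x y p q
  (x , p) ⊗ (y , q) = mul x y , closed· x y p q

  ⊖_ : K → K
  ⊖ (x , p) = let y , q , _ = +-inverse x p in y , q

  𝟘 𝟙 : K
  𝟘 = zer , zer∈R
  𝟙 = one , one∈R

  isCommutativeRing : IsCommutativeRing _≡_ _⊕_ _⊗_ ⊖_ 𝟘 𝟙
  isCommutativeRing = record
    { isRing = record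
      { +-isAbelianGroup = record
        { isGroup = record
          { isMonoid = record
            { isSemigroup = record
              { isMagma = record { isEquivalence = isEquivalence ; ∙-cong = cong₂ _⊕_ }
              ; assoc = λ (x , p) (y , q) (w , r) → K-≡ (+-assoc x y w p q r) }
            ; identity = comm∧idˡ⇒id ⊕-comm (λ (x , p) → K-≡ (+-ident x p)) }
          ; inverse = comm∧invʳ⇒inv ⊕-comm (λ (x , p) → K-≡ (proj₂ (proj₂ (+-inverse x p))))
          ; ⁻¹-cong = cong ⊖_ }
        ; comm = ⊕-comm }
      ; *-cong = cong₂ _⊗_
      ; *-assoc = λ (x , p) (y , q) (w , r) → K-≡ (·-assoc x y w p q r)
      ; *-identity = comm∧idˡ⇒id ⊗-comm (λ (x , p) → K-≡ (·-ident x p))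
      ; distrib = comm∧distrˡ⇒distr (cong₂ _⊕_) ⊗-comm (λ (x , p) (y , q) (w , r) → K-≡ (distrib x y w p q r)) }
    ; *-comm = ⊗-comm }
    where
    ⊕-comm : ∀ k l → k ⊕ l ≡ l ⊕ k
    ⊕-comm (x , p) (y , q) = K-≡ (+-comm x y p q)
    ⊗-comm : ∀ k l → k ⊗ l ≡ l ⊗ k
    ⊗-comm (x , p) (y , q) = K-≡ (·-comm x y p q)

  dec : Fin n → Maybe K
  dec x with T? (isR x)
  ... | yes p = just (x , p)
  ... | no _  = nothing

  dec-∈ : ∀ {x} (p : IsR x) → dec x ≡ just (x , p)
  dec-∈ {x} p with T? (isR x)
  ... | yes q = cong just (K-≡ refl)
  ... | no ¬p = contradiction p ¬p

  dec-proj₁ : ∀ {x k} → dec x ≡ just k → proj₁ k ≡ x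
  dec-proj₁ {x} eq′ with T? (isR x)
  dec-proj₁ refl | yes _ = refl

  open FiniteRing isCommutativeRing proj₁ dec (dec-∈ ∘ proj₂) dec-proj₁ public

  onR-view : ∀ f x → (Σ (IsR x) λ x∈R → onR f x ≡ f (x , x∈R)) ⊎ onR f x ≡ 0#
  onR-view f x with T? (isR x)
  ... | yes x∈R = inj₁ (x∈R , refl)
  ... | no _    = inj₂ refl

  module _ {v} (e : Vec (Fin n) v) where

    stage : ℕ → Vec (Fin n) 1 → Bool
    stage j = iter (λ X xs → X xs ∨ eval S (X ∷ []) (xs ++ e) cyclic-step) j (λ _ → false)

    stage-suc : ∀ j x → T (stage (suc j) (x ∷ [])) ⇔
                (T (stage j (x ∷ [])) ⊎ x ≡ zer ⊎ ∃ λ y → T (stage j (y ∷ [])) × T (plus one y x))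
    stage-suc j x = mk⇔
      (Sum.map₂ (Sum.map toWitness (λ p → let y , q = to (T-any _) p in y , to T-∧ q) ∘ to T-∨) ∘ to T-∨)
      (from T-∨ ∘ Sum.map₂ (from T-∨ ∘ Sum.map fromWitness (λ (y , q) → from (T-any _) (y , from T-∧ q))))

    -- The bound on m is strict because stage 0 is empty and 0 enters at stage 1; each later stage
    -- adds 1 once more.
    stage-multiple : ∀ j x → T (stage j (x ∷ [])) ⇔ (∃ λ m → m ℕ.< j × proj₁ (m · 1#) ≡ x)
    stage-multiple zero x = mk⇔ (λ ()) (λ ())
    stage-multiple (suc j) x = mk⇔ (forward ∘ to (stage-suc j x)) (from (stage-suc j x) ∘ backward)
      where
      forward : T (stage j (x ∷ [])) ⊎ x ≡ zer ⊎ (∃ λ y → T (stage j (y ∷ [])) × T (plus one y x)) →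
                ∃ λ m → m ℕ.< suc j × proj₁ (m · 1#) ≡ x
      forward (inj₁ h) = let m , m<j , eq′ = to (stage-multiple j x) h in m , ℕₚ.m<n⇒m<1+n m<j , eq′
      forward (inj₂ (inj₁ refl)) = 0 , s≤s z≤n , refl
      forward (inj₂ (inj₂ (y , h , p))) with to (stage-multiple j y) h | to (graph+ one y x) p
      ... | m , m<j , refl | _ , _ , refl = suc m , s≤s m<j , refl
      backward : (∃ λ m → m ℕ.< suc j × proj₁ (m · 1#) ≡ x) →
                 T (stage j (x ∷ [])) ⊎ x ≡ zer ⊎ (∃ λ y → T (stage j (y ∷ [])) × T (plus one y x))
      backward (zero , _ , eq′) = inj₂ (inj₁ (sym eq′))
      backward (suc m , s≤s m<j , eq′) = inj₂ (inj₂ (proj₁ (m · 1#) , from (stage-multiple j _) (m , m<j , refl)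
                                      , from (graph+ one _ x) (one∈R , proj₂ (m · 1#) , sym eq′)))

    -- The iteration ends at stage n, which holds m · 1 for m < n only. These are all multiples of
    -- 1, as the remainder of m modulo a positive number at most n that kills 1 gives the same
    -- multiple.
    cyclic-multiple : ∀ t → Holds (cyclicᵈ t) S e ⇔ (∃ λ k → Multiple k × proj₁ k ≡ evalT S e t)
    cyclic-multiple t = mk⇔
      (λ h → let m , _ , eq′ = to (stage-multiple (n ℕ.^ 1) x) h in m · 1# , (m , refl) , eq′)
      (λ { (k , mult , refl) → let m , m<n , eq′ = multiple-bounded mult in
           from (stage-multiple (n ℕ.^ 1) x) (m , subst (m ℕ.<_) (sym (ℕₚ.^-identityʳ n)) m<n , cong proj₁ eq′) })
      where
      x : Fin n
      x = evalT S e t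

-- Formulas for the group, the right-hand side and the matrix

private variable
  ν : ℕ

Tupleᵗ : ℕ → Set
Tupleᵗ ν = Vec (Term τr≤ ν) 5

-- Validity is a conjunct of G alone: if it fails, G is empty, the neutral element is not in it, and
-- the image is no solvable system whatever the other relations are.
memberᵈ groupᵈ : Tupleᵗ ν → Definable τr≤ ν
memberᵈ X@(x ∷ _) = equalᵈ X (replicate 5 x) ⊓ cyclicᵈ x
groupᵈ X = validᵈ ⊓ memberᵈ X

sumᵈ : Tupleᵗ ν → Tupleᵗ ν → Tupleᵗ ν → Definable τr≤ ν
sumᵈ X@(x ∷ _) Y@(y ∷ _) Z@(z ∷ _) = memberᵈ X ⊓ memberᵈ Y ⊓ equalᵈ Z (replicate 5 z) ⊓ plusᵈ x y z

-- Group elements are the constant tuples over C.  Rows are the tuples with x ∈ I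
-- and u = 0: tag t = 0 or 1 ties the occurrences at [p + q] to those at [p] or at [q],
-- respectively, and any other tag gives the equation of row x at s = p.  As x ∉ R,
-- the tags 0, 1 and x are distinct unless 0 = 1, when every system is solvable.
rhsᵈ : Tupleᵗ ν → Tupleᵗ ν → Definable τr≤ ν
rhsᵈ (x ∷ p ∷ q ∷ t ∷ u ∷ []) G = (Iᵈ x ⊓ u ≐ zerᵗ)
    ⊓ ((unit ⊓ equalᵈ G (replicate 5 oneᵗ)) ⊔ (∼ unit ⊓ equalᵈ G (replicate 5 zerᵗ)))
  where unit = ∼ t ≐ zerᵗ ⊓ ∼ t ≐ oneᵗ ⊓ ∼ p ≐ zerᵗ ⊓ bᵈ x p

-- Matches `weight` only for s ≠ 0 and under the column conditions of `entryᵈ`. The negated tag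
-- conditions follow the nested tests of `pick`.
weightᵈ : Term τr≤ ν → Tupleᵗ ν → Term τr≤ ν → Definable τr≤ ν
weightᵈ i (x ∷ p ∷ q ∷ t ∷ u ∷ []) s =
    ∃ᵈ (Aᵈ (shift i) (shift x) v0 ⊓ timesᵈ v0 (shift p) (shift s))
  ⊔ (x ≐ i ⊓ Rᵈ p ⊓ Rᵈ q ⊓
      ( (t ≐ zerᵗ ⊓ p ≐ s)
      ⊔ (∼ t ≐ zerᵗ ⊓ t ≐ oneᵗ ⊓ q ≐ s)
      ⊔ (∼ t ≐ zerᵗ ⊓ ∼ t ≐ oneᵗ ⊓ plusᵈ p q s)))

-- The conditions on x′ and u′ keep columns apart from group elements, whose first coordinate is in
-- R, and from rows, whose last coordinate is 0.
entryᵈ : Tupleᵗ ν → Tupleᵗ ν → Definable τr≤ ν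
entryᵈ (x ∷ p ∷ q ∷ t ∷ u ∷ []) Y@(x′ ∷ p′ ∷ q′ ∷ t′ ∷ u′ ∷ []) = (Iᵈ x ⊓ u ≐ zerᵗ) ⊓ (∼ Rᵈ x′ ⊓ ∼ u′ ≐ zerᵗ) ⊓
    ( (t ≐ zerᵗ ⊓ same ⊓ ∼ t′ ≐ oneᵗ)
    ⊔ (∼ t ≐ zerᵗ ⊓ t ≐ oneᵗ ⊓ same ⊓ ∼ t′ ≐ zerᵗ)
    ⊔ (∼ t ≐ zerᵗ ⊓ ∼ t ≐ oneᵗ ⊓ ∼ p ≐ zerᵗ ⊓ weightᵈ x Y p))
  where same = equalᵈ (x′ ∷ p′ ∷ q′ ∷ []) (x ∷ p ∷ q ∷ [])

tupleᵗ : ∀ k → Fin k → Tupleᵗ (k ℕ.* 5)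
tupleᵗ k i = tabulate (var ∘ combine i)

relationᵈ : ∀ R → Definable τr≤ (ar τg R ℕ.* 5)
relationᵈ zero                   = groupᵈ (tupleᵗ 1 zero)
relationᵈ (suc zero)             = entryᵈ (tupleᵗ 2 zero) (tupleᵗ 2 (suc zero))
relationᵈ (suc (suc zero))       = rhsᵈ (tupleᵗ 2 zero) (tupleᵗ 2 (suc zero))
relationᵈ (suc (suc (suc zero))) = sumᵈ (tupleᵗ 3 zero) (tupleᵗ 3 (suc zero)) (tupleᵗ 3 (suc (suc zero)))

-- The constant with index `suc zero` is the ring's 0, so the neutral element is the constant tuple
-- over 0.
open QuotientFree {τg} relationᵈ (λ _ → replicate 5 (suc zero)) using (interp; image; module Image)

-- Correctness for an arbitrary copy of the image

module Correctness {S : Struct τr≤} (s : System S) {B : Struct τg} (isImage : IsImage interp S B) where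
  open SystemRing s
  open Image S isImage
  module G = LesG B

  gt : K → Vec (Fin n) 5
  gt k = replicate 5 (proj₁ k)

  gp : K → Fin G.n
  gp k = h (gt k)

  gt-injective : ∀ {k l} → gt k ≡ gt l → k ≡ l
  gt-injective e = K-≡ (∷-injectiveˡ e)

  gp-injective : ∀ {k l} → gp k ≡ gp l → k ≡ l
  gp-injective e = gt-injective (h-injective e)

  e≡gp0 : G.e ≡ gp 0#
  e≡gp0 = sym (cst-h zero)

  Member : Vec (Fin n) 5 → K → Set
  Member X k = Multiple k × X ≡ gt k

  isG-h : ∀ X → T (G.isG (h X)) ⇔ ∃ (Member X)
  isG-h X@(x ∷ p ∷ q ∷ t ∷ u ∷ []) = mk⇔
    (λ g∈ → let _ , eq′ , cyc = to (rel-h zero (X ∷ [])) g∈ ; k , mult , k≡x = to (cyclic-multiple X v0) cyc in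
       k , mult , trans eq′ (cong (replicate 5) (sym k≡x)))
    (λ { (k , mult , refl) → from (rel-h zero (X ∷ [])) (system→valid S s {e = X} , refl , from (cyclic-multiple X v0) (k , mult , refl)) })

  sum-h : ∀ {k l} → Multiple k → Multiple l → T (G.plus (gp k) (gp l) (gp (k + l)))
  sum-h {k} {l} mk ml = from (rel-h (suc (suc (suc zero))) Xs)
    ( (refl , from (cyclic-multiple (concat Xs) v0) (k , mk , refl))
    , (refl , from (cyclic-multiple (concat Xs) v5) (l , ml , refl))
    , refl , from (graph+ _ _ _) (proj₂ k , proj₂ l , refl) )
    where
    Xs : Vec (Vec (Fin n) 5) 3
    Xs = gt k ∷ gt l ∷ gt (k + l) ∷ []

  sum-h⁻ : ∀ X Y Z → T (G.plus (h X) (h Y) (h Z)) → ∃ λ k → ∃ λ l → Member X k × Member Y l × Z ≡ gt (k + l)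
  sum-h⁻ X@(x ∷ p ∷ q ∷ t ∷ u ∷ []) Y@(x′ ∷ p′ ∷ q′ ∷ t′ ∷ u′ ∷ []) Z@(x″ ∷ p″ ∷ q″ ∷ t″ ∷ u″ ∷ []) plusXYZ
    with to (rel-h (suc (suc (suc zero))) Xs) plusXYZ
    where
    Xs : Vec (Vec (Fin n) 5) 3
    Xs = X ∷ Y ∷ Z ∷ []
  ... | (refl , cx) , (refl , cy) , refl , p
    with to (cyclic-multiple (concat (X ∷ Y ∷ Z ∷ [])) v0) cx | to (cyclic-multiple (concat (X ∷ Y ∷ Z ∷ [])) v5) cy | to (graph+ _ _ _) p
  ... | k , mk , refl | l , ml , refl | _ , _ , refl = k , l , (mk , refl) , (ml , refl) , cong (replicate 5) (cong₂ add refl refl)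

  Row Column : Vec (Fin n) 5 → Set
  Row (x ∷ p ∷ q ∷ t ∷ u ∷ []) = T (isI x) × u ≡ z
  Column (x ∷ p ∷ q ∷ t ∷ u ∷ []) = ¬ IsR x × u ≢ z

  unit? : ∀ x p t → Dec (t ≢ z × t ≢ o × p ≢ z × T (bb x p))
  unit? x p t = ¬? (t ≟ z) ×-dec ¬? (t ≟ o) ×-dec ¬? (p ≟ z) ×-dec T? (bb x p)

  rhs : Vec (Fin n) 5 → K
  rhs (x ∷ p ∷ q ∷ t ∷ u ∷ []) = unit? x p t ▸ 1#

  multiple-rhs : ∀ X → Multiple (rhs X)
  multiple-rhs (x ∷ p ∷ q ∷ t ∷ u ∷ []) = multiple-▸ (unit? x p t) multiple-1

  rhs-h : ∀ X Y → T (G.bb (h X) (h Y)) ⇔ (Row X × Y ≡ gt (rhs X))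
  rhs-h X@(x ∷ p ∷ q ∷ t ∷ u ∷ []) Y@(_ ∷ _ ∷ _ ∷ _ ∷ _ ∷ []) =
    mk⇔ (forward ∘ to (rel-h (suc (suc zero)) (X ∷ Y ∷ []))) (from (rel-h (suc (suc zero)) (X ∷ Y ∷ [])) ∘ backward)
    where
    H : Set
    H = Holds (relationᵈ (suc (suc zero))) S (concat (X ∷ Y ∷ []))
    forward : H → Row X × Y ≡ gt (rhs X)
    forward ((i∈I , u≡z) , inj₁ (yes′ , eq′)) = (from (T-isI S) i∈I , u≡z) , trans eq′ (cong gt (sym (▸-yes (unit? x p t) yes′)))
    forward ((i∈I , u≡z) , inj₂ (no′ , eq′))  = (from (T-isI S) i∈I , u≡z) , trans eq′ (cong gt (sym (▸-no (unit? x p t) no′)))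
    choose : (d : Dec _) → Row X → Y ≡ gt (d ▸ 1#) → H
    choose (yes yes′) (i∈I , u≡z) eq′ = (to (T-isI S) i∈I , u≡z) , inj₁ (yes′ , eq′)
    choose (no no′)   (i∈I , u≡z) eq′ = (to (T-isI S) i∈I , u≡z) , inj₂ (no′ , eq′)
    backward : Row X × Y ≡ gt (rhs X) → H
    backward (row , eq′) = choose (unit? x p t) row eq′

  coefficient : ∀ {i} → T (isI i) → Fin n → K
  coefficient {i} i∈I x with T? (isJ x)
  ... | yes x∈J = entry i x , entry∈R i x i∈I x∈J
  ... | no _    = 0#

  coefficient-entry : ∀ {i} (i∈I : T (isI i)) {x} → T (isJ x) → proj₁ (coefficient i∈I x) ≡ entry i x
  coefficient-entry i∈I {x} x∈J with T? (isJ x)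
  ... | yes _   = refl
  ... | no x∉J = contradiction x∈J x∉J

  b-value : ∀ {i} → T (isI i) → K
  b-value {i} i∈I = let r , bir = proj₂ (to (T-isI S) i∈I) in r , proj₂ (b-shape i r bir)

  bb-b-value : ∀ {i} (i∈I : T (isI i)) → T (bb i (proj₁ (b-value i∈I)))
  bb-b-value i∈I = proj₂ (proj₂ (to (T-isI S) i∈I))

  I∉R : ∀ {i} → T (isI i) → ¬ IsR i
  I∉R i∈I = proj₁ (to (T-isI S) i∈I)

  J∉R : ∀ {x} → T (isJ x) → ¬ IsR x
  J∉R x∈J = proj₁ (to (T-isJ S) x∈J)

  I∉J : ∀ {i} → T (isI i) → isJ i ≡ false
  I∉J {i} i∈I with isJ i in eq′
  ... | false = refl
  ... | true  = contradiction (proj₂ (to (T-isI S) i∈I)) (proj₂ (to (T-isJ S) (from T-≡ eq′)))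

  ∉R⇒≢ : ∀ {x} → ¬ IsR x → (k : K) → x ≢ proj₁ k
  ∉R⇒≢ x∉R k refl = x∉R (proj₂ k)

  -- The interpreted equations that belong to one row of the input

  module _ (z≢o : z ≢ o) where
    open Gadget isJ z≢o

    module _ {i} (i∈I : T (isI i)) where

      private
        a : Fin n → K
        a = coefficient i∈I

      Weighs : (x p q t u s : Fin n) → Set
      Weighs x p q t u s = Column (x ∷ p ∷ q ∷ t ∷ u ∷ []) ×
        ((∃ λ r → T (Ab i x r) × T (times r p s)) ⊎
         (x ≡ i × IsR p × IsR q × (t ≡ z × p ≡ s ⊎ (t ≢ z × t ≡ o × q ≡ s ⊎ t ≢ z × t ≢ o × T (plus p q s)))))

      pick-⇔ : ∀ {p q t s} (p∈R : IsR p) (q∈R : IsR q) →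
               (t ≡ z × p ≡ s ⊎ (t ≢ z × t ≡ o × q ≡ s ⊎ t ≢ z × t ≢ o × T (plus p q s))) ⇔
               proj₁ (pick t (p , p∈R) (q , q∈R)) ≡ s
      pick-⇔ {p} {q} {t} {s} p∈R q∈R with t ≟ z | t ≟ o
      ... | yes t≡z | _ = mk⇔
        (λ { (inj₁ (_ , p≡s)) → p≡s
           ; (inj₂ (inj₁ (t≢z , _))) → contradiction t≡z t≢z ; (inj₂ (inj₂ (t≢z , _))) → contradiction t≡z t≢z })
        (λ p≡s → inj₁ (t≡z , p≡s))
      ... | no t≢z | yes t≡o = mk⇔
        (λ { (inj₁ (t≡z , _)) → contradiction t≡z t≢z
           ; (inj₂ (inj₁ (_ , _ , q≡s))) → q≡s ; (inj₂ (inj₂ (_ , t≢o , _))) → contradiction t≡o t≢o })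
        (λ q≡s → inj₂ (inj₁ (t≢z , t≡o , q≡s)))
      ... | no t≢z | no t≢o = mk⇔
        (λ { (inj₁ (t≡z , _)) → contradiction t≡z t≢z ; (inj₂ (inj₁ (_ , t≡o , _))) → contradiction t≡o t≢o
           ; (inj₂ (inj₂ (_ , _ , pqs))) → sym (proj₂ (proj₂ (to (graph+ p q s) pqs))) })
        (λ e → inj₂ (inj₂ (t≢z , t≢o , from (graph+ p q s) (p∈R , q∈R , sym e))))

      -- Where the formula describes nothing, as for `u ≡ z` or p outside R, `weight` takes the
      -- default 0. Because of `s ≢ z`, no such tuple has weight s.
      weighs-⇔ : ∀ x p q t u s → s ≢ z → Weighs x p q t u s ⇔ proj₁ (weight i a (x ∷ p ∷ q ∷ t ∷ u ∷ [])) ≡ s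
      weighs-⇔ x p q t u s s≢z = mk⇔ forward (backward (isJ x) refl (u ≟ z) (x ≟ i))
        where
        w : K
        w = weight i a (x ∷ p ∷ q ∷ t ∷ u ∷ [])
        forward : Weighs x p q t u s → proj₁ w ≡ s
        forward ((x∉R , u≢z) , inj₁ (r , air , rps)) with to (A-graph i x r) air | to (graph· r p s) rps
        ... | _ , x∈J , refl | r∈R , p∈R , refl = trans
          (cong proj₁ (trans (weight-column i a x (to T-≡ x∈J) p q t u) (trans (▸-yes (¬? (u ≟ z)) u≢z) (onR-enc (a x *_) (p , p∈R)))))
          (cong (λ y → mul y p) (coefficient-entry i∈I x∈J))
        forward ((_ , u≢z) , inj₂ (refl , p∈R , q∈R , c)) = trans
          (cong proj₁ (trans (weight-relation i a (I∉J i∈I) p q t u) (trans (▸-yes (¬? (u ≟ z)) u≢z)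
            (trans (onR-enc _ (p , p∈R)) (onR-enc (pick t (p , p∈R)) (q , q∈R)))))) (to (pick-⇔ p∈R q∈R) c)
        impossible : ∀ {C : Set} → proj₁ w ≡ s → w ≡ 0# → C
        impossible e w≡0 = contradiction (trans (sym e) (cong proj₁ w≡0)) s≢z
        backward : ∀ d → isJ x ≡ d → Dec (u ≡ z) → Dec (x ≡ i) → proj₁ w ≡ s → Weighs x p q t u s
        backward false Jx _ (no x≢i) e = impossible e (weight-other i a x Jx x≢i (p ∷ q ∷ t ∷ u ∷ []))
        backward true  Jx (yes u≡z) _ e = impossible e (trans (weight-column i a x Jx p q t u) (▸-no (¬? (u ≟ z)) (contradiction u≡z)))
        backward true  Jx (no u≢z) _ e with trans (weight-column i a x Jx p q t u) (▸-yes (¬? (u ≟ z)) u≢z) | onR-view (a x *_) p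
        ... | w≡ | inj₂ e′         = impossible e (trans w≡ e′)
        ... | w≡ | inj₁ (p∈R , e′) = (J∉R x∈J , u≢z) , inj₁ (entry i x , from (A-graph i x _) (i∈I , x∈J , refl)
              , from (graph· _ p s) (entry∈R i x i∈I x∈J , p∈R
              , trans (sym e) (trans (cong proj₁ (trans w≡ e′)) (cong (λ y → mul y p) (coefficient-entry i∈I x∈J)))))
          where
          x∈J : T (isJ x)
          x∈J = from T-≡ Jx
        backward false Jx (yes u≡z) (yes refl) e = impossible e (trans (weight-relation i a Jx p q t u) (▸-no (¬? (u ≟ z)) (contradiction u≡z)))
        backward false Jx (no u≢z) (yes refl) e
          with trans (weight-relation i a Jx p q t u) (▸-yes (¬? (u ≟ z)) u≢z) | onR-view (λ r → onR (pick t r) q) p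
        ... | w≡ | inj₂ e′ = impossible e (trans w≡ e′)
        ... | w≡ | inj₁ (p∈R , e′) with onR-view (pick t (p , p∈R)) q
        ...   | inj₂ e″         = impossible e (trans w≡ (trans e′ e″))
        ...   | inj₁ (q∈R , e″) = (I∉R i∈I , u≢z) , inj₂ (refl , p∈R , q∈R
              , from (pick-⇔ p∈R q∈R) (trans (cong proj₁ (sym (trans w≡ (trans e′ e″)))) e))

      Cell : (p q t : Fin n) → Vec (Fin n) 5 → Set
      Cell p q t Y = T (G.Ab (h (i ∷ p ∷ q ∷ t ∷ z ∷ [])) (h Y))

      cell? : ∀ p q t Y → Dec (Cell p q t Y)
      cell? p q t Y = T? (G.Ab (h (i ∷ p ∷ q ∷ t ∷ z ∷ [])) (h Y))

      row-sum : (v : Vec (Fin n) 5 → K) (p q t : Fin n) → K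
      row-sum v p q t = ∑V 5 (λ Y → cell? p q t Y ▸ v Y)

      line-sum : (v : Vec (Fin n) 5 → K) (k p q : Fin n) → K
      line-sum v k p q = sum (λ t → sum (λ u → ¬? (t ≟ k) ▸ ¬? (u ≟ z) ▸ v (i ∷ p ∷ q ∷ t ∷ u ∷ [])))

      row-sum₀ : ∀ v p q → row-sum v p q z ≡ line-sum v o p q
      row-sum₀ v p q = cancels-sum (cell? p q z) v o i p q (λ x p′ q′ t u →
        mk⇔ (λ c → forward x p′ q′ t u (to (rel-h (suc zero) (X ∷ (x ∷ p′ ∷ q′ ∷ t ∷ u ∷ []) ∷ [])) c))
            (λ { (refl , t≢o , u≢z) → from (rel-h (suc zero) (X ∷ (x ∷ p′ ∷ q′ ∷ t ∷ u ∷ []) ∷ []))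
               ((to (T-isI S) i∈I , refl) , (I∉R i∈I , u≢z) , inj₁ (refl , refl , t≢o)) }))
        where
        X : Vec (Fin n) 5
        X = i ∷ p ∷ q ∷ z ∷ z ∷ []
        forward : ∀ x p′ q′ t u → Holds (relationᵈ (suc zero)) S (concat (X ∷ (x ∷ p′ ∷ q′ ∷ t ∷ u ∷ []) ∷ [])) →
                  x ∷ p′ ∷ q′ ∷ [] ≡ i ∷ p ∷ q ∷ [] × t ≢ o × u ≢ z
        forward x p′ q′ t u (_ , (_ , u≢z) , inj₁ (_ , same , t≢o)) = same , t≢o , u≢z
        forward x p′ q′ t u (_ , _ , inj₂ (inj₁ (z≢z , _))) = contradiction refl z≢z
        forward x p′ q′ t u (_ , _ , inj₂ (inj₂ (z≢z , _))) = contradiction refl z≢z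

      row-sum₁ : ∀ v p q → row-sum v p q o ≡ line-sum v z p q
      row-sum₁ v p q = cancels-sum (cell? p q o) v z i p q (λ x p′ q′ t u →
        mk⇔ (λ c → forward x p′ q′ t u (to (rel-h (suc zero) (X ∷ (x ∷ p′ ∷ q′ ∷ t ∷ u ∷ []) ∷ [])) c))
            (λ { (refl , t≢z , u≢z) → from (rel-h (suc zero) (X ∷ (x ∷ p′ ∷ q′ ∷ t ∷ u ∷ []) ∷ []))
               ((to (T-isI S) i∈I , refl) , (I∉R i∈I , u≢z) , inj₂ (inj₁ (z≢o ∘ sym , refl , refl , t≢z))) }))
        where
        X : Vec (Fin n) 5
        X = i ∷ p ∷ q ∷ o ∷ z ∷ []
        forward : ∀ x p′ q′ t u → Holds (relationᵈ (suc zero)) S (concat (X ∷ (x ∷ p′ ∷ q′ ∷ t ∷ u ∷ []) ∷ [])) →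
                  x ∷ p′ ∷ q′ ∷ [] ≡ i ∷ p ∷ q ∷ [] × t ≢ z × u ≢ z
        forward x p′ q′ t u (_ , _ , inj₁ (o≡z , _)) = contradiction (sym o≡z) z≢o
        forward x p′ q′ t u (_ , (_ , u≢z) , inj₂ (inj₁ (_ , _ , same , t≢z))) = same , t≢z , u≢z
        forward x p′ q′ t u (_ , _ , inj₂ (inj₂ (_ , o≢o , _))) = contradiction refl o≢o

      row-sum₂ : ∀ v p q t → t ≢ z → t ≢ o → p ≢ z → row-sum v p q t ≡ ∑V 5 (λ Y → proj₁ (weight i a Y) ≟ p ▸ v Y)
      row-sum₂ v p q t t≢z t≢o p≢z = ∑V-cong 5 cell
        where
        X : Vec (Fin n) 5
        X = i ∷ p ∷ q ∷ t ∷ z ∷ []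
        forward : ∀ x p′ q′ t′ u′ → Holds (relationᵈ (suc zero)) S (concat (X ∷ (x ∷ p′ ∷ q′ ∷ t′ ∷ u′ ∷ []) ∷ [])) →
                  Weighs x p′ q′ t′ u′ p
        forward x p′ q′ t′ u′ (_ , _ , inj₁ (t≡z , _)) = contradiction t≡z t≢z
        forward x p′ q′ t′ u′ (_ , _ , inj₂ (inj₁ (_ , t≡o , _))) = contradiction t≡o t≢o
        forward x p′ q′ t′ u′ (_ , col , inj₂ (inj₂ (_ , _ , _ , w))) = col , w
        cell : ∀ Y → (cell? p q t Y ▸ v Y) ≡ (proj₁ (weight i a Y) ≟ p ▸ v Y)
        cell Y@(x ∷ p′ ∷ q′ ∷ t′ ∷ u′ ∷ []) = ▸-cong (cell? p q t Y) (proj₁ (weight i a Y) ≟ p)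
          (to (weighs-⇔ x p′ q′ t′ u′ p p≢z) ∘ forward x p′ q′ t′ u′ ∘ to (rel-h (suc zero) (X ∷ Y ∷ [])))
          (λ e → let col , w = from (weighs-⇔ x p′ q′ t′ u′ p p≢z) e in
             from (rel-h (suc zero) (X ∷ Y ∷ [])) ((to (T-isI S) i∈I , refl) , col , inj₂ (inj₂ (t≢z , t≢o , p≢z , w))))
          (λ _ → refl)

      -- The tuples that would stand for the dropped equation at s = 0 are still rows of the image;
      -- they must have no entries, as their right-hand side is 0.
      row-sum₃ : ∀ v q t → t ≢ z → t ≢ o → row-sum v z q t ≡ 0#
      row-sum₃ v q t t≢z t≢o = ∑V-0 5 cell
        where
        X : Vec (Fin n) 5
        X = i ∷ z ∷ q ∷ t ∷ z ∷ []
        impossible : ∀ x p′ q′ t′ u′ → ¬ Holds (relationᵈ (suc zero)) S (concat (X ∷ (x ∷ p′ ∷ q′ ∷ t′ ∷ u′ ∷ []) ∷ []))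
        impossible x p′ q′ t′ u′ (_ , _ , inj₁ (t≡z , _)) = t≢z t≡z
        impossible x p′ q′ t′ u′ (_ , _ , inj₂ (inj₁ (_ , t≡o , _))) = t≢o t≡o
        impossible x p′ q′ t′ u′ (_ , _ , inj₂ (inj₂ (_ , _ , z≢z , _))) = z≢z refl
        cell : ∀ Y → (cell? z q t Y ▸ v Y) ≡ 0#
        cell Y@(x ∷ p′ ∷ q′ ∷ t′ ∷ u′ ∷ []) =
          ▸-no (cell? z q t Y) (impossible x p′ q′ t′ u′ ∘ to (rel-h (suc zero) (X ∷ Y ∷ [])))

      b : K
      b = b-value i∈I

      bb-⇔ : ∀ p → T (bb i p) ⇔ proj₁ b ≡ p
      bb-⇔ p = mk⇔ (b-fun i _ p (bb-b-value i∈I)) (λ { refl → bb-b-value i∈I })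

      rhs-b : ∀ p q t u → t ≢ z → t ≢ o → p ≢ z → rhs (i ∷ p ∷ q ∷ t ∷ u ∷ []) ≡ (proj₁ b ≟ p ▸ 1#)
      rhs-b p q t u t≢z t≢o p≢z = ▸-cong (unit? i p t) (proj₁ b ≟ p)
        (λ (_ , _ , _ , bip) → to (bb-⇔ p) bip) (λ e → t≢z , t≢o , p≢z , from (bb-⇔ p) e) (λ _ → refl)

      Satisfies : (Vec (Fin n) 5 → K) → Set
      Satisfies v = ∀ p q t → row-sum v p q t ≡ rhs (i ∷ p ∷ q ∷ t ∷ z ∷ [])

      satisfies⇒solves : ∀ v → Satisfies v → sum (λ x → if isJ x then a x * collect v x else 0#) ≡ b
      satisfies⇒solves v sat = collect-solves {i} {a} {b} {v}
        (λ p q → trans (sym (row-sum₀ v p q)) (trans (sat p q z) (▸-no (unit? i p z) (λ (z≢z , _) → z≢z refl))))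
        (λ p q → trans (sym (row-sum₁ v p q)) (trans (sat p q o) (▸-no (unit? i p o) (λ (_ , o≢o , _) → o≢o refl))))
        -- Any q would serve as the third coordinate; the tag `i` lies outside R, hence is neither
        -- `z` nor `o`.
        (λ p p≢z → trans (sym (row-sum₂ v p p i i≢z i≢o p≢z)) (trans (sat p p i) (rhs-b p p i z i≢z i≢o p≢z)))
        where
        i≢z : i ≢ z
        i≢z = ∉R⇒≢ (I∉R i∈I) 0#
        i≢o : i ≢ o
        i≢o = ∉R⇒≢ (I∉R i∈I) 1#

      assign-satisfies : ∀ {c ζ} → (∀ φ → φ 0# ≡ 0# →
        sum (λ x → φ (if isJ x then a x * c x else 0#)) + ∑R (λ r → ∑R (λ s → ζ i r s * Δ φ r s)) ≡ φ b) →
        Satisfies (assign c ζ)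
      assign-satisfies {c} {ζ} telescopes p q t = cases (t ≟ z) (t ≟ o) (p ≟ z)
        where
        v : Vec (Fin n) 5 → K
        v = assign c ζ
        i≢z : i ≢ z
        i≢z = ∉R⇒≢ (I∉R i∈I) 0#
        i≢o : i ≢ o
        i≢o = ∉R⇒≢ (I∉R i∈I) 1#
        cases : Dec (t ≡ z) → Dec (t ≡ o) → Dec (p ≡ z) → row-sum v p q t ≡ rhs (i ∷ p ∷ q ∷ t ∷ z ∷ [])
        cases (yes refl) _ _ = trans (row-sum₀ v p q)
          (trans (assign-cancels₀ {c} {ζ} {i} {a} {b} (I∉J i∈I) i≢z i≢o telescopes p q) (sym (▸-no (unit? i p z) (λ (z≢z , _) → z≢z refl))))
        cases (no _) (yes refl) _ = trans (row-sum₁ v p q)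
          (trans (assign-cancels₁ {c} {ζ} {i} {a} {b} (I∉J i∈I) i≢z i≢o telescopes p q) (sym (▸-no (unit? i p o) (λ (_ , o≢o , _) → o≢o refl))))
        cases (no t≢z) (no t≢o) (no p≢z) = trans (row-sum₂ v p q t t≢z t≢o p≢z)
          (trans (assign-balances {c} {ζ} {i} {a} {b} (I∉J i∈I) i≢z i≢o telescopes p p≢z) (sym (rhs-b p q t z t≢z t≢o p≢z)))
        cases (no t≢z) (no t≢o) (yes refl) = trans (row-sum₃ v q t t≢z t≢o)
          (sym (▸-no (unit? i z t) (λ (_ , _ , z≢z , _) → z≢z refl)))

  -- Transfer of solutions between the two systems

  open CommutativeRing ring using (*-identityˡ; zeroˡ; +-identityˡ; -‿inverseʳ) renaming (+-assoc to ⊕-assoc; +-comm to ⊕-comm)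

  1≡0⇒trivial : z ≡ o → ∀ (k l : K) → k ≡ l
  1≡0⇒trivial z≡o k l = trans (k≡0 k) (sym (k≡0 l))
    where
    k≡0 : ∀ k → k ≡ 0#
    k≡0 k = trans (sym (*-identityˡ k)) (trans (cong (_* k) (sym (enc-injective z≡o))) (zeroˡ k))

  Solution : (Fin n → K) → Set
  Solution c = ∀ {i} (i∈I : T (isI i)) → sum (λ x → if isJ x then coefficient i∈I x * c x else 0#) ≡ b-value i∈I

  RowSolution : (Vec (Fin n) 5 → K) → Set
  RowSolution v = ∀ X → Row X → ∑V 5 (λ Y → T? (G.Ab (h X) (h Y)) ▸ v Y) ≡ rhs X

  row-solution⇒solution : ∃ RowSolution → ∃ Solution
  row-solution⇒solution (v , rows) with z ≟ o
  ... | yes z≡o = (λ _ → 0#) , λ _ → 1≡0⇒trivial z≡o _ _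
  ... | no z≢o  = Gadget.collect isJ z≢o v , λ {i} i∈I → satisfies⇒solves z≢o i∈I v (λ p q t → rows _ (i∈I , refl))

  solution⇒row-solution : ∃ Solution → ∃ λ v → (∀ Y → Multiple (v Y)) × RowSolution v
  solution⇒row-solution (c , solution) with z ≟ o
  ... | yes z≡o = (λ _ → 0#) , (λ _ → multiple-0) , λ _ _ → 1≡0⇒trivial z≡o _ _
  ... | no z≢o  = assign c ζ , multiple-assign multiple-neg (λ x → proj₁ (proj₂ (row-telescope x))) ,
      λ { (i ∷ p ∷ q ∷ t ∷ u ∷ []) (i∈I , refl) → assign-satisfies z≢o i∈I (proj₂ (proj₂ (row-telescope i)) i∈I) p q t }
    where
    open Gadget isJ z≢o
    -- `assign` needs coefficients for every element of the universe, so `ζ` is chosen before any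
    -- proof of membership in I and is 0 outside I. Irrelevance of that proof transports the
    -- identity to the one supplied later.
    row-telescope : ∀ x → ∃ λ (ζ : K → K → K) → (∀ r s → Multiple (ζ r s)) × (∀ (x∈I : T (isI x)) φ → φ 0# ≡ 0# →
      sum (λ y → φ (if isJ y then coefficient x∈I y * c y else 0#)) + ∑R (λ r → ∑R (λ s → ζ r s * Δ φ r s)) ≡ φ (b-value x∈I))
    row-telescope x with T? (isI x)
    ... | no x∉I  = (λ _ _ → 0#) , (λ _ _ → multiple-0) , λ x∈I → contradiction x∈I x∉I
    ... | yes x∈I = let ζ , mζ , tζ = telescope (λ y → if isJ y then coefficient x∈I y * c y else 0#) in
      ζ , mζ , λ x∈I′ φ φ0 → subst
        (λ x∈I → sum (λ y → φ (if isJ y then coefficient x∈I y * c y else 0#)) +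
                 ∑R (λ r → ∑R (λ s → ζ r s * Δ φ r s)) ≡ φ (b-value x∈I))
        (T-irrelevant x∈I x∈I′) (trans (tζ φ φ0) (cong φ (solution x∈I)))
    ζ : Fin n → K → K → K
    ζ x = proj₁ (row-telescope x)

  -- Both encodings add up by a fold with an operation on bare elements. The map `r` represents ring
  -- elements there, and the invariant `P` on partial sums is needed because the operation of the
  -- image is controlled only on multiples of 1.
  foldr-∑ : ∀ {A C : Set} (r : K → C) (P : K → Set) (d : A → Bool) (k : A → K) (op : A → C → C) → P 0# →
            (∀ x l → T (d x) → P l → P (k x + l) × op x (r l) ≡ r (k x + l)) → ∀ {M} (f : Fin M → A) →
            P (sum (λ j → if d (f j) then k (f j) else 0#)) ×
            L.foldr (λ x acc → if d x then op x acc else acc) (r 0#) (L.tabulate f) ≡ r (sum (λ j → if d (f j) then k (f j) else 0#))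
  foldr-∑ r P d k op P0 hom {zero}  f = P0 , refl
  foldr-∑ r P d k op P0 hom {suc M} f with d (f zero) in eq′ | foldr-∑ r P d k op P0 hom (f ∘ suc)
  ... | true  | Pl , e = let Pkl , e′ = hom (f zero) _ (from T-≡ eq′) Pl in Pkl , trans (cong (op (f zero)) e) e′
  ... | false | Pl , e = subst P (sym (+-identityˡ _)) Pl , trans e (cong r (sym (+-identityˡ _)))

  foldr-R : ∀ {sol : Fin n → Fin n} {c : Fin n → K} → (∀ j → T (isJ j) → sol j ≡ proj₁ (c j)) → ∀ {i} (i∈I : T (isI i)) →
            L.foldr (λ j acc → if isJ j then add (mul (entry i j) (sol j)) acc else acc) zer (L.allFin n) ≡
            proj₁ (sum (λ x → if isJ x then coefficient i∈I x * c x else 0#))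
  -- The operations of the structure agree with those of K on all of R, so the invariant is trivial:
  -- an inhabited type, with `0#` as its witness.
  foldr-R {sol} {c} sol≡c {i} i∈I = proj₂ (foldr-∑ proj₁ (λ _ → K) isJ (λ x → coefficient i∈I x * c x)
    (λ j acc → add (mul (entry i j) (sol j)) acc) 0#
    (λ j l j∈J _ → 0# , cong (λ y → add y (proj₁ l)) (cong₂ mul (sym (coefficient-entry i∈I j∈J)) (sol≡c j j∈J))) id)

  bb⇒I : ∀ {i r} → T (bb i r) → T (isI i)
  bb⇒I {i} {r} bir = from (T-isI S) (proj₁ (b-shape i r bir) , r , bir)

  solution⇒solveCR : ∃ Solution → SolveCR≤ S
  solution⇒solveCR (c , solution) = record
    { System s
    ; sol = proj₁ ∘ c
    ; sol∈R = λ j _ → proj₂ (c j)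
    ; solves = λ i r bir → let i∈I = bb⇒I bir in
        trans (foldr-R (λ _ _ → refl) i∈I) (trans (cong proj₁ (solution i∈I)) (b-fun i _ r (bb-b-value i∈I) bir)) }

  val : Fin G.n → K
  val y = onR id (head (g y))

  val-gp : ∀ k → val (gp k) ≡ k
  val-gp k = trans (cong (onR id ∘ head) (g-h (gt k))) (onR-enc id k)

  InG : Fin G.n → Set
  InG x = ∃ λ k → Multiple k × x ≡ gp k

  isG-⇔ : ∀ x → T (G.isG x) ⇔ InG x
  isG-⇔ x = mk⇔
    (λ x∈G → let k , mk , e = to (isG-h (g x)) (subst (T ∘ G.isG) (sym (h-g x)) x∈G) in k , mk , trans (sym (h-g x)) (cong h e))
    (λ { (k , mk , refl) → from (isG-h (gt k)) (k , mk , refl) })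

  SumInG : (x y w : Fin G.n) → Set
  SumInG x y w = ∃ λ k → ∃ λ l → Multiple k × Multiple l × x ≡ gp k × y ≡ gp l × w ≡ gp (k + l)

  plus-⇔ : ∀ x y w → T (G.plus x y w) ⇔ SumInG x y w
  plus-⇔ x y w = mk⇔ forward (λ { (k , l , mk , ml , refl , refl , refl) → sum-h mk ml })
    where
    forward : T (G.plus x y w) → SumInG x y w
    forward p with sum-h⁻ (g x) (g y) (g w) (subst T (sym (trans (cong₂ (λ x y → G.plus x y (h (g w))) (h-g x) (h-g y)) (cong (G.plus x y) (h-g w)))) p)
    ... | k , l , (mk , e₁) , (ml , e₂) , e₃ = k , l , mk , ml , trans (sym (h-g x)) (cong h e₁)
                                             , trans (sym (h-g y)) (cong h e₂) , trans (sym (h-g w)) (cong h e₃)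

  bb-⇔G : ∀ x y → T (G.bb x y) ⇔ (Row (g x) × y ≡ gp (rhs (g x)))
  bb-⇔G x y = mk⇔
    (λ b → let row , e = to (rhs-h (g x) (g y)) (subst T (sym (cong₂ G.bb (h-g x) (h-g y))) b) in row , trans (sym (h-g y)) (cong h e))
    (λ { (row , refl) → subst (λ x′ → T (G.bb x′ (gp (rhs (g x))))) (h-g x) (from (rhs-h (g x) (gt (rhs (g x)))) (row , refl)) })

  Adds : (Fin G.n → Fin G.n → Fin G.n) → Set
  Adds _∙_ = ∀ {k l} → Multiple k → Multiple l → gp k ∙ gp l ≡ gp (k + l)

  -- The enumeration of the universe of B is unrelated to tuples; once the fold is a sum in the
  -- commutative group of K, it can be reindexed along the bijection `h`.
  foldr-G : ∀ {_∙_} → Adds _∙_ → ∀ {sol : Fin G.n → Fin G.n} i → (∀ j → T (G.Ab i j) → T (G.isG (sol j))) →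
            L.foldr (λ j acc → if G.Ab i j then sol j ∙ acc else acc) G.e (L.allFin G.n) ≡
            gp (∑V 5 (λ Y → T? (G.Ab i (h Y)) ▸ val (sol (h Y))))
  foldr-G {_∙_} adds {sol} i sol∈G = begin
    L.foldr (λ j acc → if G.Ab i j then sol j ∙ acc else acc) G.e (L.allFin G.n)
      ≡⟨ cong (λ e → L.foldr (λ j acc → if G.Ab i j then sol j ∙ acc else acc) e (L.allFin G.n)) e≡gp0 ⟩
    L.foldr (λ j acc → if G.Ab i j then sol j ∙ acc else acc) (gp 0#) (L.allFin G.n)
      ≡⟨ proj₂ (foldr-∑ gp Multiple (G.Ab i) (val ∘ sol) (λ j acc → sol j ∙ acc) multiple-0 hom id) ⟩
    gp (sum (λ j → if G.Ab i j then val (sol j) else 0#))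
      ≡⟨ cong gp (∑-reindex h g h-g g-h (λ j → if G.Ab i j then val (sol j) else 0#)) ⟩
    gp (∑V 5 (λ Y → T? (G.Ab i (h Y)) ▸ val (sol (h Y)))) ∎
    where
    open ≡-Reasoning
    hom : ∀ j l → T (G.Ab i j) → Multiple l → Multiple (val (sol j) + l) × sol j ∙ gp l ≡ gp (val (sol j) + l)
    hom j l aij ml with sol j | to (isG-⇔ (sol j)) (sol∈G j aij)
    ... | _ | k , mk , refl rewrite val-gp k = multiple-+ mk ml , adds mk ml

  solveCycG⇒row-solution : SolveCycG B → ∃ RowSolution
  solveCycG⇒row-solution D = val ∘ D.sol ∘ h , λ X row →
    gp-injective (trans (sym (foldr-G {D.add} adds (h X) (λ j a → D.sol∈G j (proj₂ (D.A-shape (h X) j a)))))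
                        (D.solves (h X) (gp (rhs X)) (from (rhs-h X (gt (rhs X))) (row , refl))))
    where
    module D = SolveCycG D
    -- The addition of a given solution is unknown, but its graph determines it on C.
    adds : Adds D.add
    adds mk ml = sym (proj₂ (proj₂ (to (D.graph _ _ _) (sum-h mk ml))))

  row-solution⇒solveCycG : (∃ λ v → (∀ Y → Multiple (v Y)) × RowSolution v) → SolveCycG B
  row-solution⇒solveCycG (v , mv , rows) = record
    { add = _∙_
    ; graph = λ x y w → mk⇔
        (λ p → plus-to (to (plus-⇔ x y w) p))
        (λ (x∈G , y∈G , e) → plus-from e (to (isG-⇔ x) x∈G) (to (isG-⇔ y) y∈G))
    ; closed = λ x y x∈G y∈G → closed (to (isG-⇔ x) x∈G) (to (isG-⇔ y) y∈G)
    ; e∈G = from (isG-⇔ G.e) (0# , multiple-0 , e≡gp0)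
    ; assoc = λ x y w _ _ _ → assoc x y w
    ; comm = λ x y _ _ → cong gp (⊕-comm (val x) (val y))
    ; identity = λ x x∈G → identity (to (isG-⇔ x) x∈G)
    ; inverse = λ x x∈G → inverse (to (isG-⇔ x) x∈G)
    ; cyclic = gp 1# , from (isG-⇔ _) (1# , multiple-1 , refl) , λ x x∈G → generated (to (isG-⇔ x) x∈G)
    ; b-shape = λ x y b → b-shape′ (to (bb-⇔G x y) b)
    ; b-fun = λ x y y′ b b′ → trans (proj₂ (to (bb-⇔G x y) b)) (sym (proj₂ (to (bb-⇔G x y′) b′)))
    ; A-shape = λ x y a → A-shape′ x y (subst T (sym (cong₂ G.Ab (h-g x) (h-g y))) a)
    ; sol = sol
    ; sol∈G = λ j _ → sol∈G j
    ; solves = λ i y b → let row , y≡ = to (bb-⇔G i y) b in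
        trans (foldr-G {_∙_} adds i (λ j _ → sol∈G j)) (trans (cong gp (trans (∑V-cong 5 (λ Y →
          trans (cong (λ x → T? (G.Ab x (h Y)) ▸ val (sol (h Y))) (sym (h-g i)))
                (cong (λ k → T? (G.Ab (h (g i)) (h Y)) ▸ k) (trans (val-gp _) (cong v (g-h Y))))))
          (rows (g i) row))) (sym y≡)) }
    where
    _∙_ : Fin G.n → Fin G.n → Fin G.n
    x ∙ y = gp (val x + val y)
    sol : Fin G.n → Fin G.n
    sol = gp ∘ v ∘ g
    sol∈G : ∀ j → T (G.isG (sol j))
    sol∈G j = from (isG-⇔ _) (_ , mv (g j) , refl)
    adds : Adds _∙_
    adds {k} {l} _ _ = cong gp (cong₂ _+_ (val-gp k) (val-gp l))
    plus-to : ∀ {x y w} → SumInG x y w → T (G.isG x) × T (G.isG y) × w ≡ x ∙ y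
    plus-to (k , l , mk , ml , refl , refl , refl) =
      from (isG-⇔ _) (k , mk , refl) , from (isG-⇔ _) (l , ml , refl) , sym (adds mk ml)
    plus-from : ∀ {x y w} → w ≡ x ∙ y → InG x → InG y → T (G.plus x y w)
    plus-from {x} {y} refl (k , mk , x≡) (l , ml , y≡) = from (plus-⇔ x y _) (k , l , mk , ml , x≡ , y≡
      , cong gp (cong₂ _+_ (trans (cong val x≡) (val-gp k)) (trans (cong val y≡) (val-gp l))))
    closed : ∀ {x y} → InG x → InG y → T (G.isG (x ∙ y))
    closed (k , mk , refl) (l , ml , refl) = from (isG-⇔ _) (k + l , multiple-+ mk ml , adds mk ml)
    assoc : ∀ x y w → (x ∙ y) ∙ w ≡ x ∙ (y ∙ w)
    assoc x y w = cong gp (trans (cong (_+ val w) (val-gp (val x + val y)))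
      (trans (⊕-assoc (val x) (val y) (val w)) (cong (val x +_) (sym (val-gp (val y + val w))))))
    identity : ∀ {x} → InG x → G.e ∙ x ≡ x
    identity (k , mk , refl) = trans (cong (_∙ gp k) e≡gp0) (trans (adds multiple-0 mk) (cong gp (+-identityˡ k)))
    inverse : ∀ {x} → InG x → ∃ λ y → T (G.isG y) × x ∙ y ≡ G.e
    inverse (k , mk , refl) = gp (- k) , from (isG-⇔ _) (- k , multiple-neg mk , refl)
                            , trans (adds mk (multiple-neg mk)) (trans (cong gp (-‿inverseʳ k)) (sym e≡gp0))
    iterate : ∀ m → iter (gp 1# ∙_) m G.e ≡ gp (m · 1#)
    iterate zero    = e≡gp0
    iterate (suc m) = trans (cong (gp 1# ∙_) (iterate m)) (adds multiple-1 (m , refl))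
    generated : ∀ {x} → InG x → ∃ λ m → x ≡ iter (gp 1# ∙_) m G.e
    generated (_ , (m , refl) , refl) = m , sym (iterate m)
    row∉G : ∀ X → Row X → ¬ T (G.isG (h X))
    row∉G X@(_ ∷ _ ∷ _ ∷ _ ∷ _ ∷ []) (i∈I , _) X∈G = let k , _ , e = to (isG-h X) X∈G in
      I∉R i∈I (subst IsR (sym (∷-injectiveˡ e)) (proj₂ k))
    column∉G : ∀ X → Column X → ¬ T (G.isG (h X))
    column∉G X@(_ ∷ _ ∷ _ ∷ _ ∷ _ ∷ []) (x∉R , _) X∈G = let k , _ , e = to (isG-h X) X∈G in
      x∉R (subst IsR (sym (∷-injectiveˡ e)) (proj₂ k))
    column∉row : ∀ X → Column X → ¬ Row X
    column∉row (_ ∷ _ ∷ _ ∷ _ ∷ _ ∷ []) (_ , u≢z) (_ , u≡z) = u≢z u≡z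
    b-shape′ : ∀ {x y} → Row (g x) × y ≡ gp (rhs (g x)) → ¬ T (G.isG x) × T (G.isG y)
    b-shape′ {x} (row , refl) = subst (λ x → ¬ T (G.isG x)) (h-g x) (row∉G (g x) row)
                              , from (isG-⇔ _) (rhs (g x) , multiple-rhs (g x) , refl)
    entry⇒row-column : ∀ X Y → T (G.Ab (h X) (h Y)) → Row X × Column Y
    entry⇒row-column X@(_ ∷ _ ∷ _ ∷ _ ∷ _ ∷ []) Y@(_ ∷ _ ∷ _ ∷ _ ∷ _ ∷ []) a =
      let (i∈I , u≡z) , col , _ = to (rel-h (suc zero) (X ∷ Y ∷ [])) a in (from (T-isI S) i∈I , u≡z) , col
    A-shape′ : ∀ x y → T (G.Ab (h (g x)) (h (g y))) → T (G.isI x) × T (G.isJ y)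
    A-shape′ x y a = let row , col = entry⇒row-column (g x) (g y) a in
        from T-∧ (from T-not (subst (λ x → ¬ T (G.isG x)) (h-g x) (row∉G (g x) row))
                 , from (T-any (G.bb x)) (gp (rhs (g x)) , from (bb-⇔G x _) (row , refl)))
      , from T-∧ (from T-not (subst (λ y → ¬ T (G.isG y)) (h-g y) (column∉G (g y) col))
                 , from T-not (λ b → column∉row (g y) col (proj₁ (to (bb-⇔G y _) (proj₂ (to (T-any (G.bb y)) b))))))

  solve⇒solution : (sol : Fin n → Fin n) → (∀ j → T (isJ j) → IsR (sol j)) →
                   (∀ i r → T (bb i r) → L.foldr (λ j acc → if isJ j then add (mul (entry i j) (sol j)) acc else acc) zer (L.allFin n) ≡ r) →
                   ∃ Solution
  solve⇒solution sol sol∈R solves = c , λ i∈I →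
    K-≡ (trans (sym (foldr-R sol≡c i∈I)) (solves _ _ (bb-b-value i∈I)))
    where
    c : Fin n → K
    c j with T? (isJ j)
    ... | yes j∈J = sol j , sol∈R j j∈J
    ... | no _    = 0#
    sol≡c : ∀ j → T (isJ j) → sol j ≡ proj₁ (c j)
    sol≡c j j∈J with T? (isJ j)
    ... | yes _   = refl
    ... | no j∉J = contradiction j∈J j∉J

theorem2p1 : SolveCR≤ ≤FP SolveCycG
theorem2p1 = 5 , interp , λ S → image S , mk⇔
  (λ σ → let B , isImage = image S
             open Correctness (system σ) isImage
             open SolveCR≤ σ using (sol; sol∈R; solves)
         in B , isImage , row-solution⇒solveCycG (solution⇒row-solution (solve⇒solution sol sol∈R solves)))
  (λ (B , isImage , D) →
     let open Image S isImage
         -- Solvability puts the neutral element into G, and membership in G includes validity of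
         -- the input.
         valid = proj₁ (to (rel-h zero (replicate 5 (cst S (suc zero)) ∷ []))
                           (subst (λ x → T (LesG.isG B x)) (sym (cst-h zero)) (SolveCycG.e∈G D)))
         open Correctness (valid→system S {e = replicate 5 (cst S (suc zero))} valid) isImage
           using (solution⇒solveCR; row-solution⇒solution; solveCycG⇒row-solution)
     in solution⇒solveCR (row-solution⇒solution (solveCycG⇒row-solution D)))
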